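{- Let $A$ be a set of actions. Then $\mathsf{Mil}\precsim\mathsf{cMil}_1$, that is, every theorem of $\mathsf{Mil}$ is a theorem of $\mathsf{cMil}_1$. What is more, every derivation in $\mathsf{Mil}$ with conclusion $e=f$ can be transformed effectively into a derivation with conclusion $e=f$ in $\mathsf{cMil}_1$.
   Context: **Star expressions.** For a set $A$ of actions, the set $StExp(A)$ of star expressions is generated by $e ::= 0\mid 1\mid a\mid (e_1+e_2)\mid (e_1\cdot e_2)\mid e^*$ with $a\in A$. $\sum_{i=1}^n e_i$ is $0$ for $n=0$, $e_1$ for $n=1$, and $(\sum_{i=1}^{n-1}e_i)+e_n$ for $n>1$. $Eq(A)$ is the set of formal equations $e=f$ with $e,f\in StExp(A)$. Immediate termination $e{\downarrow}$ is defined inductively by: $1{\downarrow}$; $(e_1+e_2){\downarrow}$ if $e_1{\downarrow}$ or $e_2{\downarrow}$; $(e_1\cdot e_2){\downarrow}$ if $e_1{\downarrow}$ and $e_2{\downarrow}$; $(e^*){\downarrow}$ always. Write $e{\not\downarrow}$ if $e{\downarrow}$ does not hold. **Proof systems.** An $Eq(A)$-based proof system is a Hilbert-style proof system whose formulas are the equations in $Eq(A)$; $e=_S f$ means that $e=f$ is derivable in $S$ without assumptions (is a theorem of $S$). It is $\mathcal{EL}$-based if its rules include those of equational logic: reflexivity, symmetry, transitivity, and the context rule (from $e=f$ infer $C[e]=C[f]$ for one-hole star expression contexts $C$). $S+\Gamma$ adds the equations in $\Gamma\subseteq Eq(A)$ as axioms to $S$; $S+R$ adds the rule $R$. $\mathsf{ACI}$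 consists of the axioms $(e+f)+g=e+(f+g)$, $e+f=f+e$, $e+e=e$; $\mathsf{ACI}\sqsubseteq S$ means that all of these are axioms of $S$. $\mathsf{Mil}^-$ is the $\mathcal{EL}$-based system with exactly the rules of equational logic and the axiom schemes: $(e+f)+g=e+(f+g)$, $e+0=e$, $e+f=f+e$, $e+e=e$, $(e\cdot f)\cdot g=e\cdot(f\cdot g)$, $(e+f)\cdot g=e\cdot g+f\cdot g$, $1\cdot e=e$, $e\cdot 1=e$, $0\cdot e=0$, $e^*=1+e\cdot e^*$, $e^*=(1+e)^*$. Milner's system is $\mathsf{Mil}=\mathsf{Mil}^-+\mathrm{RSP}^*$, where $\mathrm{RSP}^*$ is the rule: from $e=f\cdot e+g$ infer $e=f^*\cdot g$, provided $f{\not\downarrow}$. **1-charts and solutions.** A 1-chart is $C=\langle V,A,1,v_s,\to,\downarrow\rangle$ with a finite set $V$ of vertices, a set $A$ of (proper) action labels, an empty-step label $1\notin A$, a start vertex $v_s\in V$, a transition relation $\to\,\subseteq V\times(A\cup\{1\})\times V$, and a set $\downarrow\,\subseteq V$ of vertices with immediate termination. Transitions with label in $A$ are proper; those with label $1$ are 1-transitions. $C$ is weakly guarded if it has no cycle of 1-transitions. For an $\mathcal{EL}$-based system $S$ with $\mathsf{ACI}\sqsubseteq S$, a function $s:V\to StExp(A)$ is an $S$-provable solution of $C$ if for every $v\in V$: $s(v)=_S\tau_C(v)+\sum_{i=1}^n\underline a_i\cdot s(v_i)$, where $v\xrightarrow{\underline a_i}v_i$ ($1\le i\le n$, $\underline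 a_i\in A\cup\{1\}$) is a (possibly redundant) list of all transitions from $v$, and $\tau_C(v)$ is $1$ if $v{\downarrow}$ and $0$ otherwise. **Guarded LLEE-1-charts.** A loop 1-chart is a 1-chart such that (L1) there is an infinite path from the start vertex, (L2) every infinite path from the start vertex returns to it after a positive number of transitions, (L3) immediate termination is only permitted at the start vertex. Its transitions from the start vertex are its loop-entry transitions, all other transitions belong to its body. A loop sub-1-chart of $C$ is a loop 1-chart $L$ that is a sub-1-chart of $C$ with some vertex $v$ of $C$ as start vertex, formed, for a nonempty set $U$ of transitions of $C$ from $v$ (the loop-entry transitions of $L$), by all vertices and transitions on paths that start with a transition in $U$ and continue onward until $v$ is reached again. A multi-step loop elimination of loop sub-1-charts $L_1,\dots,L_n$ ($n\ge1$) from $C$, where their sets of loop-entry transitions are pairwise disjoint and no start vertex of one is in the body of another one, removes all loop-entry transitions of $L_1,\dots,L_n$, and then all vertices and transitions that become unreachable. A run (sequence of multi-steps) from $C$ is successful if it leads to a 1-chart without an infinite path; it is layered if it never removes loop-entry transitions that depart from a vertex in the body of a previously eliminated loop sub-1-chart. A LLEE-witness of $C$ is the labeling of the transitions of $C$ by natural numbers that records a successful layered run: marking label $n\ge1$ for transitions removed as loop-entry transitions in the $n$-th multi-step ('loop-entry transitions'), label $0$ for all other transitions ('body transitions'). It is guarded if all of its loop-entry transitions are proper. A guarded LLEE-1-chart is a 1-chart that has a guarded LLEE-witness. **Coinductive proofs.** Let $S$ be $\mathcal{EL}$-based with $\mathsf{ACI}\sqsubseteq S$. A coinductive proof over $S$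 of $e_1=e_2$ is a pair $\langle C,L\rangle$ of a weakly guarded 1-chart $C$ with start vertex $v_s$ and a function $L:V(C)\to Eq(A)$, $v\mapsto (L_1(v)=L_2(v))$, such that $L_1$ and $L_2$ are $S$-provable solutions of $C$ and $L_1(v_s)\equiv e_1$, $L_2(v_s)\equiv e_2$ (syntactic equality). It is LLEE-witnessed if $C$ is a guarded LLEE-1-chart. $e_1\overset{\mathrm{LLEE}}{=}_S e_2$ means that there is a LLEE-witnessed coinductive proof over $S$ of $e_1=e_2$. **The system $\mathsf{cMil}_1$.** The rule $\mathrm{LCoProof}_1$ permits to infer $e=f$ from a premise $g=h$ provided $e\overset{\mathrm{LLEE}}{=}_{\mathsf{Mil}^-+\{g=h\}}f$. $\mathsf{cMil}_1$ is $\mathsf{Mil}^-$ extended by the rule $\mathrm{LCoProof}_1$. -}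

module Defs where

open import Level using (Level; 0ℓ; _⊔_) renaming (suc to lsuc)
open import Data.Bool using (if_then_else_)
open import Data.Empty.Polymorphic using (⊥)
open import Data.Fin using (Fin)
open import Data.List using (List; []; _∷_; foldl; map)
open import Data.List.Membership.Propositional using () renaming (_∈_ to _∈ᴸ_)
open import Data.List.Relation.Unary.All using (All)
open import Data.Nat using (ℕ; zero; suc)
open import Data.Product using (∃; ∃-syntax; _×_; _,_; proj₁; proj₂)
open import Data.Sum using (_⊎_; inj₁; inj₂)
open import Data.Unit.Polymorphic using (⊤)
open import Function using (_∘_)
open import Function.Bundles using (_↔_; _⇔_)
open import Relation.Binary.Construct.Closure.ReflexiveTransitive using (Star; ε)
open import Relation.Binary.Construct.Closure.Transitive using (TransClosure)
open import Relation.Binary.PropositionalEquality using (_≡_; _≢_; refl; sym)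
open import Relation.Nullary using (¬_; does)
open import Relation.Unary using (Pred; Decidable; Empty; Satisfiable; _∈_; _∉_; _⊆_; _∩_; _∖_; ｛_｝)

private
  variable
    a ℓ ℓ₁ ℓ₂ : Level
    A : Set a

infixl 6 _⊕_
infixl 7 _⊙_
infix  8 _*
infix  5 _≐_
infix  4 _↓ _⊢_ _≾_
infixl 3 _+ᴿ_ _+ᴬ_

------------------------------------------------------------------------
-- Star expressions

data StExp (A : Set a) : Set a where
  𝟘 𝟙  : StExp A
  atom : A → StExp A
  _⊕_  : StExp A → StExp A → StExp A
  _⊙_  : StExp A → StExp A → StExp A
  _*   : StExp A → StExp A

-- Sums associate to the left, and a sum over a non-empty list does not
-- contain 𝟘 as a summand.
∑ : List (StExp A) → StExp A
∑ []       = 𝟘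
∑ (e ∷ es) = foldl _⊕_ e es

data _↓ {A : Set a} : StExp A → Set a where
  𝟙↓  : 𝟙 ↓
  ⊕↓ˡ : ∀ {e f} → e ↓ → (e ⊕ f) ↓
  ⊕↓ʳ : ∀ {e f} → f ↓ → (e ⊕ f) ↓
  ⊙↓  : ∀ {e f} → e ↓ → f ↓ → (e ⊙ f) ↓
  *↓  : ∀ {e} → (e *) ↓

data Context (A : Set a) : Set a where
  □    : Context A
  _⊕·_ : StExp A → Context A → Context A
  _·⊕_ : Context A → StExp A → Context A
  _⊙·_ : StExp A → Context A → Context A
  _·⊙_ : Context A → StExp A → Context A
  _·*  : Context A → Context A

plug : Context A → StExp A → StExp A
plug □        x = x
plug (e ⊕· C) x = e ⊕ plug C x
plug (C ·⊕ e) x = plug C x ⊕ e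
plug (e ⊙· C) x = e ⊙ plug C x
plug (C ·⊙ e) x = plug C x ⊙ e
plug (C ·*)   x = (plug C x) *

record Eq (A : Set a) : Set a where
  constructor _≐_
  field
    lhs rhs : StExp A

open Eq public

------------------------------------------------------------------------
-- Hilbert-style proof systems over Eq A

-- A system is given by the set of instances of its rules, each relating a
-- list of premises to a conclusion; axioms are the rules without premises.
Rules : Set a → (ℓ : Level) → Set (a ⊔ lsuc ℓ)
Rules A ℓ = List (Eq A) → Pred (Eq A) ℓ

-- The type of derivations without assumptions; E is a theorem of S when
-- this type is inhabited.
data _⊢_ {A : Set a} (S : Rules A ℓ) : Eq A → Set (a ⊔ ℓ) where
  by : ∀ {Ps E} → S Ps E → All (S ⊢_) Ps → S ⊢ E

_≾_ : {A : Set a} → Rules A ℓ₁ → Rules A ℓ₂ → Set (a ⊔ ℓ₁ ⊔ ℓ₂)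
S ≾ T = ∀ E → S ⊢ E → T ⊢ E

_+ᴿ_ : {A : Set a} → Rules A ℓ₁ → Rules A ℓ₂ → Rules A (ℓ₁ ⊔ ℓ₂)
(S +ᴿ R) Ps E = S Ps E ⊎ R Ps E

data Axioms {A : Set a} (Γ : Pred (Eq A) ℓ) : Rules A (a ⊔ ℓ) where
  axiom : ∀ {E} → E ∈ Γ → Axioms Γ [] E

_+ᴬ_ : {A : Set a} → Rules A ℓ₁ → Pred (Eq A) ℓ₂ → Rules A (a ⊔ ℓ₁ ⊔ ℓ₂)
S +ᴬ Γ = S +ᴿ Axioms Γ

data EL {A : Set a} : Rules A a where
  reflexivity  : ∀ {e} → EL [] (e ≐ e)
  symmetry     : ∀ {e f} → EL ((e ≐ f) ∷ []) (f ≐ e)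
  transitivity : ∀ {e f g} → EL ((e ≐ f) ∷ (f ≐ g) ∷ []) (e ≐ g)
  context      : ∀ {e f} (C : Context A) → EL ((e ≐ f) ∷ []) (plug C e ≐ plug C f)

data MilAxiom {A : Set a} : Pred (Eq A) a where
  ⊕-assoc   : ∀ {e f g} → MilAxiom ((e ⊕ f) ⊕ g ≐ e ⊕ (f ⊕ g))
  ⊕-neutral : ∀ {e}     → MilAxiom (e ⊕ 𝟘 ≐ e)
  ⊕-comm    : ∀ {e f}   → MilAxiom (e ⊕ f ≐ f ⊕ e)
  ⊕-idem    : ∀ {e}     → MilAxiom (e ⊕ e ≐ e)
  ⊙-assoc   : ∀ {e f g} → MilAxiom ((e ⊙ f) ⊙ g ≐ e ⊙ (f ⊙ g))
  r-distr   : ∀ {e f g} → MilAxiom ((e ⊕ f) ⊙ g ≐ e ⊙ g ⊕ f ⊙ g)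
  ⊙-idˡ     : ∀ {e}     → MilAxiom (𝟙 ⊙ e ≐ e)
  ⊙-idʳ     : ∀ {e}     → MilAxiom (e ⊙ 𝟙 ≐ e)
  deadlock  : ∀ {e}     → MilAxiom (𝟘 ⊙ e ≐ 𝟘)
  *-rec     : ∀ {e}     → MilAxiom (e * ≐ 𝟙 ⊕ e ⊙ e *)
  *-trm     : ∀ {e}     → MilAxiom (e * ≐ (𝟙 ⊕ e) *)

Mil⁻ : {A : Set a} → Rules A a
Mil⁻ = EL +ᴬ MilAxiom

data RSP* {A : Set a} : Rules A a where
  rsp* : ∀ {e f g} → ¬ (f ↓) → RSP* ((e ≐ f ⊙ e ⊕ g) ∷ []) (e ≐ f * ⊙ g)

Mil : {A : Set a} → Rules A a
Mil = Mil⁻ +ᴿ RSP*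

------------------------------------------------------------------------
-- 1-charts

data Label (A : Set a) : Set a where
  𝟏   : Label A
  act : A → Label A

Proper : {A : Set a} → Label A → Set a
Proper {A = A} l = ∃[ b ] (l ≡ act {A = A} b)

⌊_⌋ : Label A → StExp A
⌊ 𝟏 ⌋     = 𝟙
⌊ act b ⌋ = atom b

-- Termination is required to be decidable because τ branches on it.
record OneChart (A : Set a) : Set (lsuc a) where
  field
    V            : Set
    size         : ℕ
    finite       : V ↔ Fin size
    start        : V
    Trans        : Pred (V × Label A × V) a
    Terminating  : Pred V 0ℓ
    terminating? : Decidable Terminating

  Transition : Set a
  Transition = V × Label A × V

  source : Transition → V
  source = proj₁

  target : Transition → V
  target = proj₂ ∘ proj₂

  τ : V → StExp A
  τ v = if does (terminating? v) then 𝟙 else 𝟘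

WeaklyGuarded : {A : Set a} → OneChart A → Set a
WeaklyGuarded C = ∀ v → ¬ TransClosure (λ x y → (x , 𝟏 , y) ∈ Trans) v v
  where open OneChart C

-- Duplicate entries are allowed.
ListsTransitionsFrom : {A : Set a} (C : OneChart A) →
                       OneChart.V C → List (Label A × OneChart.V C) → Set a
ListsTransitionsFrom C v ts =
  ∀ l w → ((v , l , w) ∈ OneChart.Trans C) ⇔ ((l , w) ∈ᴸ ts)

-- Meant for systems S that contain the rules EL and the axioms of
-- associativity, commutativity and idempotence of _⊕_, for which it does not
-- matter which list of the transitions from v is used.
ProvableSolution : {A : Set a} (S : Rules A ℓ) (C : OneChart A) →
                   (OneChart.V C → StExp A) → Set (a ⊔ ℓ)
ProvableSolution S C s =
  ∀ v → ∃[ ts ] (ListsTransitionsFrom C v ts ×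
    S ⊢ (s v ≐ OneChart.τ C v ⊕ ∑ (map (λ t → ⌊ proj₁ t ⌋ ⊙ s (proj₂ t)) ts)))

------------------------------------------------------------------------
-- Loop elimination

-- Immediate termination in a sub-1-chart is inherited from C.
record SubChart {A : Set a} (C : OneChart A) : Set (lsuc a) where
  open OneChart C using (V; Transition; source; target)
  field
    Vert    : Pred V a
    Trans   : Pred Transition a
    start   : V
    start∈  : start ∈ Vert
    Trans⊆  : Trans ⊆ OneChart.Trans C
    source∈ : ∀ {t} → t ∈ Trans → source t ∈ Vert
    target∈ : ∀ {t} → t ∈ Trans → target t ∈ Vert

module _ {A : Set a} {C : OneChart A} where

  open OneChart C using (V; Transition; source; target; Terminating)

  record InfinitePath (T : Pred Transition a) : Set a where
    field
      vertex : ℕ → V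
      label  : ℕ → Label A
      step   : ∀ i → (vertex i , label i , vertex (suc i)) ∈ T

  open InfinitePath using (vertex)

  Reachable : Pred Transition a → V → Pred V a
  Reachable T = Star (λ x y → ∃[ l ] ((x , l , y) ∈ T))

  record IsLoop (L : SubChart C) : Set a where
    open SubChart L
    field
      L1 : ∃[ p ] (vertex {T = Trans} p 0 ≡ start)
      L2 : (p : InfinitePath Trans) → vertex p 0 ≡ start →
           ∃[ n ] (vertex p (suc n) ≡ start)
      L3 : ∀ {v} → v ∈ Vert → Terminating v → v ≡ start

  -- The transitions on paths that start with a transition in U and stop at
  -- the latest when v is reached again. Such a path need not reach v at all.
  data Onward (T : Pred Transition a) (v : V) (U : Pred Transition a) :
              Pred Transition a where
    entry    : ∀ {t} → t ∈ U → Onward T v U t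
    continue : ∀ {t t′} → Onward T v U t → target t ≢ v →
               t′ ∈ T → source t′ ≡ target t → Onward T v U t′

  record EntrySet (D : SubChart C) : Set (lsuc a) where
    field
      start    : V
      Entry    : Pred Transition a
      Entry⊆   : Entry ⊆ SubChart.Trans D
      from     : ∀ {t} → t ∈ Entry → source t ≡ start
      nonempty : Satisfiable Entry

  generated : {D : SubChart C} → EntrySet D → SubChart C
  generated {D} E = record
    { Vert    = λ w → w ≡ start ⊎ (∃[ t ] (t ∈ Gen × target t ≡ w))
    ; Trans   = Gen
    ; start   = start
    ; start∈  = inj₁ refl
    ; Trans⊆  = SubChart.Trans⊆ D ∘ Gen⊆
    ; source∈ = src
    ; target∈ = λ {t} g → inj₂ (t , g , refl)
    }
    where
    open EntrySet E
    Gen : Pred Transition a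
    Gen = Onward (SubChart.Trans D) start Entry
    Gen⊆ : Gen ⊆ SubChart.Trans D
    Gen⊆ (entry u)          = Entry⊆ u
    Gen⊆ (continue _ _ t _) = t
    src : ∀ {t} → t ∈ Gen →
          source t ≡ start ⊎ (∃[ t′ ] (t′ ∈ Gen × target t′ ≡ source t))
    src (entry u)                = inj₁ (from u)
    src (continue {t} g _ _ eq) = inj₂ (t , g , sym eq)

  record LoopSubChart (D : SubChart C) : Set (lsuc a) where
    field
      entrySet : EntrySet D
      isLoop   : IsLoop (generated entrySet)
    open EntrySet entrySet public using (start; Entry)

    -- A vertex is in the body if it belongs to the loop sub-1-chart and is
    -- not its start vertex.
    BodyVertex : Pred V a
    BodyVertex w = w ∈ SubChart.Vert (generated entrySet) × w ≢ start

  record MultiStep (D : SubChart C) : Set (lsuc a) where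
    field
      n-1      : ℕ
      loop     : Fin (suc n-1) → LoopSubChart D
      disjoint : ∀ i j → i ≢ j →
                 Empty (LoopSubChart.Entry (loop i) ∩ LoopSubChart.Entry (loop j))
      apart    : ∀ i j → i ≢ j →
                 LoopSubChart.start (loop i) ∉ LoopSubChart.BodyVertex (loop j)

    Removed : Pred Transition a
    Removed t = ∃[ i ] (t ∈ LoopSubChart.Entry (loop i))

    InBody : Pred V a
    InBody v = ∃[ i ] (v ∈ LoopSubChart.BodyVertex (loop i))

    BecomesUnreachable : Pred V a
    BecomesUnreachable v =
      Reachable (SubChart.Trans D) (SubChart.start D) v ×
      ¬ Reachable (SubChart.Trans D ∖ Removed) (SubChart.start D) v

    -- Removing a vertex removes all transitions from it and to it.
    after : SubChart C
    after = record
      { Vert    = Vert′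
      ; Trans   = λ t → t ∈ (SubChart.Trans D ∖ Removed) ×
                        source t ∈ Vert′ × target t ∈ Vert′
      ; start   = SubChart.start D
      ; start∈  = SubChart.start∈ D , λ b → proj₂ b ε
      ; Trans⊆  = λ t → SubChart.Trans⊆ D (proj₁ (proj₁ t))
      ; source∈ = λ t → proj₁ (proj₂ t)
      ; target∈ = λ t → proj₂ (proj₂ t)
      }
      where
      Vert′ : Pred V a
      Vert′ = SubChart.Vert D ∖ BecomesUnreachable

  data Run : SubChart C → SubChart C → Set (lsuc a) where
    done   : ∀ {D} → Run D D
    _then_ : ∀ {D D′} (m : MultiStep D) → Run (MultiStep.after m) D′ → Run D D′

  -- RemovedAt r n: the loop-entry transitions of the (n+1)-th multi-step of r.
  RemovedAt : ∀ {D D′} → Run D D′ → ℕ → Pred Transition a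
  RemovedAt done       _       _ = ⊥
  RemovedAt (m then r) zero    t = t ∈ MultiStep.Removed m
  RemovedAt (m then r) (suc n) t = t ∈ RemovedAt r n

  Successful : ∀ {D D′} → Run D D′ → Set a
  Successful {D′ = D′} _ = ¬ InfinitePath (SubChart.Trans D′)

  Layered : ∀ {D D′} → Run D D′ → Set a
  Layered done       = ⊤
  Layered (m then r) =
    (∀ n t → t ∈ RemovedAt r n → source t ∉ MultiStep.InBody m) × Layered r

full : {A : Set a} (C : OneChart A) → SubChart C
full C = record
  { Vert    = λ _ → ⊤
  ; Trans   = OneChart.Trans C
  ; start   = OneChart.start C
  ; start∈  = _
  ; Trans⊆  = λ t → t
  ; source∈ = _
  ; target∈ = _
  }

-- The marking is a function on all triples; its values outside the
-- transitions of C are irrelevant. A transition of C is marked 0 precisely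
-- when no multi-step removes it as a loop-entry transition.
record LLEEWitness {A : Set a} (C : OneChart A) : Set (lsuc a) where
  open OneChart C using (Trans; Transition)
  field
    marking    : Transition → ℕ
    {result}   : SubChart C
    run        : Run (full C) result
    successful : Successful run
    layered    : Layered run
    records    : ∀ {t} → t ∈ Trans → ∀ n → (marking t ≡ suc n) ⇔ (t ∈ RemovedAt run n)

  Guarded : Set a
  Guarded = ∀ {v l w} → (v , l , w) ∈ Trans → marking (v , l , w) ≢ 0 → Proper l

GuardedLLEE : {A : Set a} → OneChart A → Set (lsuc a)
GuardedLLEE C = ∃[ W ] LLEEWitness.Guarded {C = C} W

------------------------------------------------------------------------
-- Coinductive proofs

record CoinductiveProof {A : Set a} (S : Rules A ℓ) (e₁ e₂ : StExp A) :
                        Set (lsuc a ⊔ ℓ) where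
  field
    chart         : OneChart A
    weaklyGuarded : WeaklyGuarded chart
    L             : OneChart.V chart → Eq A
    solutionˡ     : ProvableSolution S chart (lhs ∘ L)
    solutionʳ     : ProvableSolution S chart (rhs ∘ L)
    startˡ        : lhs (L (OneChart.start chart)) ≡ e₁
    startʳ        : rhs (L (OneChart.start chart)) ≡ e₂

LLEEProvable : {A : Set a} (S : Rules A ℓ) → StExp A → StExp A → Set (lsuc a ⊔ ℓ)
LLEEProvable S e₁ e₂ =
  ∃[ P ] GuardedLLEE (CoinductiveProof.chart {S = S} {e₁ = e₁} {e₂ = e₂} P)

data LCoProof₁ {A : Set a} : Rules A (lsuc a) where
  lcoproof₁ : ∀ {e f g h} → LLEEProvable (Mil⁻ +ᴬ ｛ g ≐ h ｝) e f →
              LCoProof₁ ((g ≐ h) ∷ []) (e ≐ f)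

cMil₁ : {A : Set a} → Rules A (lsuc a)
cMil₁ = Mil⁻ +ᴿ LCoProof₁

{-# OPTIONS --safe #-}
-- An application of RSP* to e = f · e + g becomes one coinductive proof over
-- the premise. Its 1-chart is a position automaton of f* · g in which a
-- terminating position in the body of a star gets a 1-transition back to the
-- vertex of that star. Sending the vertex of f* to x and each position p of f
-- to p · x gives a solution for every x with x = f · x + g, in particular for
-- x = e and for x = f* · g. For the LLEE-witness the loops at the star vertices
-- are eliminated one at a time, inner ones first: without loop-entry transitions
-- the automaton is acyclic, so every path in a body returns to the star vertex
-- or ends. A star whose body cannot terminate after a proper step has no loop;
-- it satisfies e* = 1 + e · 0 instead.

module Submission where

open import Defs
open import Level using (Level; _⊔_) renaming (suc to lsuc)
open import Algebra.Bundles using (CommutativeMonoid)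
import Algebra.Properties.CommutativeSemigroup as CommutativeSemigroupProperties
open import Data.Bool using (Bool; true; false; T; T?; _∧_; _∨_; if_then_else_)
import Data.Empty as Empty
import Data.Empty.Polymorphic as Poly
open import Data.Fin using (Fin; zero; suc; toℕ; fromℕ<)
open import Data.Fin.Properties
  using (toℕ-injective; toℕ-fromℕ<; toℕ<n; toℕ-↑ˡ; toℕ-↑ʳ; 0↔⊥; 1↔⊤; +↔⊎)
open import Data.List using (List; []; _∷_; _++_; map)
open import Data.List.Membership.Propositional using (_∈_)
open import Data.List.Membership.Propositional.Properties
  using (∈-map⁺; ∈-map⁻; ∈-++⁺ˡ; ∈-++⁺ʳ; ∈-++⁻)
open import Data.List.Properties using (map-∘)
open import Data.List.Relation.Unary.All using (All; []; _∷_)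
open import Data.List.Relation.Unary.Any using (here)
import Data.Maybe as Maybe
open import Data.Maybe using (Maybe; just; nothing; maybe)
open import Data.Maybe.Properties using (just-injective)
open import Data.Nat using (ℕ; zero; suc; _+_; _≤_; _<_; z≤n; s≤s)
open import Data.Nat.Induction using (<-wellFounded)
open import Data.Nat.Properties
  using (_≟_; ≤-trans; ≤-reflexive; <-irrefl; <-trans; <-≤-trans; <⇒≤; ≤∧≢⇒<;
         m≤m+n; m<m+n; +-identityʳ; +-suc; +-monoʳ-<; suc-injective)
open import Data.Product using (∃; ∃-syntax; _×_; _,_; proj₁; proj₂; map₂)
open import Data.Sum using (_⊎_; inj₁; inj₂; [_,_]′)
open import Data.Sum.Function.Propositional using (_⊎-↔_)
open import Data.Unit using (⊤; tt)
open import Function using (_∘_; id; const)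
open import Function.Bundles using (_↔_; _⇔_; mk⇔; Inverse; Injection; Equivalence)
open import Function.Properties.Inverse using (Inverse⇒Injection; ↔-sym; ↔-trans)
open import Induction.WellFounded using (Acc; acc)
open import Relation.Binary.Bundles using (Setoid)
open import Relation.Binary.Construct.Closure.ReflexiveTransitive
  using (Star; ε; _◅_; _◅◅_; gmap)
open import Relation.Binary.Construct.Closure.Transitive using (TransClosure; [_]; _∷_)
open import Relation.Binary.PropositionalEquality
  using (_≡_; _≢_; refl; sym; trans; cong; subst; subst₂)
import Relation.Binary.Reasoning.Setoid as SetoidReasoning
open import Relation.Nullary using (¬_; Dec; yes; no; contradiction)
open import Relation.Unary using (Pred; ｛_｝)

-- A multi-step deletes not only loop-entry transitions but also whatever becomes unreachable, and
-- each later stage would have to account for the shrunken vertex set. The automata are arranged so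
-- that no vertex is ever deleted. This is why `chart` begins with a fresh vertex carrying copies of
-- the initial transitions of `f * ⊙ g`: a start vertex that is itself the root of a loop could lose
-- the way into the body.
--
-- A 1-transition leads back to the star vertex because the usual copies of the initial transitions
-- would break L2: the position of `a *` would step to itself without ever meeting the star vertex.
--
-- Only right distributivity is an axiom, so a continuation `x` can be carried through a sum only as
-- a right factor.

private
  variable
    a ℓ ℓ₁ ℓ₂ : Level
    A : Set a

-- Automata with loops

data Location : Set where
  outside root inside : Location

-- A transition from x to y is a loop-entry transition of i if mark x y ≡ just i,
-- and a body transition if mark x y ≡ nothing. The loop i starts at the vertex
-- with loc i x ≡ root, and inside are its body vertices. The loops are
-- eliminated in the order of their indices.
record Graph (A : Set a) : Set (lsuc a) where
  field
    P       : Set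
    size    : ℕ
    finite  : P ↔ Fin size
    term    : P → Bool
    init    : List (Label A × P)
    steps   : P → List (Label A × P)
    -- The relations compute by cases on the positions; the equivalent lists feed the sums in the
    -- solution equations.
    Init    : Label A → P → Set a
    Step    : P → Label A → P → Set a
    init⇔   : ∀ l q → Init l q ⇔ ((l , q) ∈ init)
    steps⇔  : ∀ p l q → Step p l q ⇔ ((l , q) ∈ steps p)
    Loop    : Set
    loops   : ℕ
    enum    : Loop ↔ Fin loops
    -- It depends on the end points only, so parallel transitions are removed together.
    mark    : P → P → Maybe Loop
    loc     : Loop → P → Location
    rank    : P → ℕ
    bound   : ℕ

  index : Loop → ℕ
  index i = toℕ (Inverse.to enum i)

  BodyStep : P → P → Set a
  BodyStep x y = ∃[ l ] (Step x l y × mark x y ≡ nothing)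

  field
    init-proper  : ∀ l q → Init l q → Proper l
    rank<bound   : ∀ x → rank x < bound
    body-rank    : ∀ x l y → Step x l y → mark x y ≡ nothing → rank y < rank x
    entry-proper : ∀ x l y i → Step x l y → mark x y ≡ just i → Proper l
    entry-loc    : ∀ x y i → mark x y ≡ just i → loc i x ≡ root × loc i y ≡ inside
    root-unique  : ∀ i x y → loc i x ≡ root → loc i y ≡ root → x ≡ y
    stay         : ∀ i x l y → Step x l y → loc i x ≡ inside → loc i y ≢ outside
    inside-term  : ∀ i x → loc i x ≡ inside → ¬ T (term x)
    -- This one condition yields both acyclic bodies at the time of elimination and layeredness of
    -- the run.
    nested       : ∀ i j x → loc i x ≡ inside → loc j x ≡ root → index j < index i
    cycle        : ∀ i → ∃[ x ] ∃[ l ] ∃[ y ]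
                   (Step x l y × mark x y ≡ just i × Star BodyStep y x)
    -- A loop can be entered from outside only by transitions that duplicate
    -- its loop-entry transitions; hence eliminating it makes no vertex
    -- unreachable.
    init-gate    : ∀ i l q x k y → Init l q → loc i q ≢ outside →
                   Step x k y → mark x y ≡ just i → ∃[ k′ ] Init k′ y
    gate         : ∀ i z l q x k y → Step z l q → loc i z ≡ outside → loc i q ≢ outside →
                   Step x k y → mark x y ≡ just i →
                   ∃[ k′ ] (Step z k′ y × mark z y ≡ mark z q)

  -- After the first step only body steps are allowed: the path becomes part of the cycle of an
  -- enclosing star, and inner loop-entry transitions are gone when that star is eliminated.
  ExitPath : Set a
  ExitPath = ∃[ l ] ∃[ x ] ∃[ y ] (Init l x × Star BodyStep x y × T (term y))

-- Loop elimination in the order of the enumeration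

module Elimination {A : Set a} (G : Graph A)
  (p₀ : Graph.P G) (p₀-outside : ∀ i → Graph.loc G i p₀ ≡ outside) where

  open Graph G

  chart : OneChart A
  chart = record
    { V            = P
    ; size         = size
    ; finite       = finite
    ; start        = p₀
    ; Trans        = λ (x , l , y) → Step x l y
    ; Terminating  = T ∘ term
    ; terminating? = T? ∘ term
    }

  open OneChart chart using (Transition; source; target)

  index-injective : ∀ {i j} → index i ≡ index j → i ≡ j
  index-injective eq = Injection.injective (Inverse⇒Injection enum) (toℕ-injective eq)

  mark≟just : ∀ x y i → Dec (mark x y ≡ just i)
  mark≟just x y i with mark x y
  ... | nothing = no λ ()
  ... | just j with index j ≟ index i
  ...   | yes eq = yes (cong just (index-injective eq))
  ...   | no neq = no λ { refl → neq refl }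

  -- Loop-entry transitions are proper, so every 1-transition is a body transition, and weak
  -- guardedness comes from the rank too.
  silent-rank : ∀ {x y} → Step x 𝟏 y → rank y < rank x
  silent-rank {x} {y} s with mark x y in eq
  ... | nothing = body-rank x 𝟏 y s eq
  ... | just i with entry-proper x 𝟏 y i s eq
  ...   | _ , ()

  weaklyGuarded : WeaklyGuarded chart
  weaklyGuarded v c = <-irrefl refl (descend c)
    where
    descend : ∀ {x y} → TransClosure (λ x y → Step x 𝟏 y) x y → rank y < rank x
    descend [ s ]   = silent-rank s
    descend (s ∷ c) = <-trans (descend c) (silent-rank s)

  -- `keeps` and `kept` describe the transitions of `D` by their marks alone: those that are
  -- unmarked or marked with an index from `n` on.
  record Stage (n : ℕ) (D : SubChart chart) : Set a where
    field
      start-outside : ∀ i → loc i (SubChart.start D) ≡ outside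
      vertices      : ∀ x → SubChart.Vert D x
      keeps         : ∀ {x l y} → Step x l y → (∀ i → mark x y ≡ just i → n ≤ index i) →
                      SubChart.Trans D (x , l , y)
      kept          : ∀ {x l y} i → SubChart.Trans D (x , l , y) → mark x y ≡ just i →
                      n ≤ index i

  module _ {n : ℕ} {D : SubChart chart} (stage : Stage n D)
           (i : Loop) (index≡n : index i ≡ n) where

    open Stage stage

    private
      v w : P
      k   : Label A
      v = proj₁ (cycle i)
      k = proj₁ (proj₂ (cycle i))
      w = proj₁ (proj₂ (proj₂ (cycle i)))

      v→w : Step v k w
      v→w = proj₁ (proj₂ (proj₂ (proj₂ (cycle i))))

      v→w-entry : mark v w ≡ just i
      v→w-entry = proj₁ (proj₂ (proj₂ (proj₂ (proj₂ (cycle i)))))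

      back : Star BodyStep w v
      back = proj₂ (proj₂ (proj₂ (proj₂ (proj₂ (cycle i)))))

      v-root : loc i v ≡ root
      v-root = proj₁ (entry-loc v w i v→w-entry)

    IsEntry : Pred Transition a
    IsEntry (x , l , y) = Step x l y × mark x y ≡ just i

    entries : EntrySet D
    entries = record
      { start    = v
      ; Entry    = IsEntry
      ; Entry⊆   = λ (s , m) → keeps s λ j m′ →
                   ≤-reflexive (trans (sym index≡n) (cong index (just-injective (trans (sym m) m′))))
      ; from     = λ {(x , l , y)} (_ , m) →
                   root-unique i x v (proj₁ (entry-loc x y i m)) v-root
      ; nonempty = (v , k , w) , v→w , v→w-entry
      }

    private
      Gen : Pred Transition a
      Gen = SubChart.Trans (generated entries)

    Gen⇒Step : ∀ {x l y} → Gen (x , l , y) → Step x l y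
    Gen⇒Step = SubChart.Trans⊆ (generated entries)

    inside⊎start : ∀ x → loc i x ≢ outside → loc i x ≡ inside ⊎ x ≡ v
    inside⊎start x ≢out with loc i x in eq
    ... | outside = contradiction refl ≢out
    ... | root    = inj₂ (root-unique i x v eq v-root)
    ... | inside  = inj₁ refl

    inside≢start : ∀ {x} → loc i x ≡ inside → x ≢ v
    inside≢start ins refl with trans (sym ins) v-root
    ... | ()

    -- `Onward` continues only from targets other than `v`; these are inside by induction, and
    -- `stay` forbids leaving the loop from there.
    Gen-target : ∀ {t} → Gen t → loc i (target t) ≡ inside ⊎ target t ≡ v
    Gen-target {x , _ , y} (entry (_ , m)) = inj₁ (proj₂ (entry-loc x y i m))
    Gen-target {x , l , y} (continue {t} g ≢v t′ refl) with Gen-target g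
    ... | inj₁ ins = inside⊎start y (stay i x l y (SubChart.Trans⊆ D t′) ins)
    ... | inj₂ ≡v  = contradiction ≡v ≢v

    -- By `nested`, a loop rooted inside loop `i` has an index below `n`. Its entries are gone at
    -- this stage, so only body transitions depart from inside.
    Gen-rank : ∀ {x l y} → Gen (x , l , y) → loc i x ≡ inside → rank y < rank x
    Gen-rank {x} {l} {y} g ins with mark x y in eq
    ... | nothing = body-rank x l y (Gen⇒Step g) eq
    ... | just j  = contradiction (<-≤-trans index-j<n (kept j (Gen⊆D g) eq)) (<-irrefl refl)
      where
      index-j<n : index j < n
      index-j<n = subst (index j <_) index≡n (nested i j x ins (proj₁ (entry-loc x y j eq)))
      Gen⊆D : ∀ {t} → Gen t → SubChart.Trans D t
      Gen⊆D (entry e)           = EntrySet.Entry⊆ entries e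
      Gen⊆D (continue _ _ t′ _) = t′

    private
      -- For L1 an infinite path circulates along the cycle of the loop. A state in the body carries
      -- the rest of the way back; if `v` is met earlier, the round restarts.
      data State : P → Set a where
        at-start : State v
        in-body  : ∀ {t} → Gen t → loc i (target t) ≡ inside →
                   Star BodyStep (target t) v → State (target t)

      advance : ∀ {x} → State x → ∃[ l ] ∃[ y ] (Gen (x , l , y) × State y)
      advance at-start =
        k , w , entry (v→w , v→w-entry) ,
        in-body (entry (v→w , v→w-entry)) (proj₂ (entry-loc v w i v→w-entry)) back
      advance (in-body g ins ε) = contradiction refl (inside≢start ins)
      advance (in-body {t} g ins (_◅_ {j = y} (l , s , m) rest)) = l , y , g′ , next
        where
        g′ : Gen (target t , l , y)
        g′ = continue g (inside≢start ins)
               (keeps s λ j m′ → contradiction (trans (sym m) m′) λ ()) refl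
        next : State y
        next with Gen-target g′
        ... | inj₁ ins′ = in-body g′ ins′ rest
        ... | inj₂ refl = at-start

      orbit : ℕ → ∃ State
      orbit zero    = v , at-start
      orbit (suc m) = let _ , y , _ , s = advance (proj₂ (orbit m)) in y , s

    -- Ranks fall as long as the path stays inside, so it must hit `v`. The recursion looks at
    -- vertex `suc m` because L2 asks for a positive number of transitions.
    returns : (p : InfinitePath {C = chart} Gen) → ∀ m →
              Acc _<_ (rank (InfinitePath.vertex p (suc m))) →
              ∃[ m′ ] (InfinitePath.vertex p (suc m′) ≡ v)
    returns p m (acc rec) with Gen-target (InfinitePath.step p m)
    ... | inj₂ ≡v  = m , ≡v
    ... | inj₁ ins = returns p (suc m) (rec (Gen-rank (InfinitePath.step p (suc m)) ins))

    loop : LoopSubChart D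
    loop = record
      { entrySet = entries
      ; isLoop   = record
        { L1 = record
            { vertex = λ m → proj₁ (orbit m)
            ; label  = λ m → proj₁ (advance (proj₂ (orbit m)))
            ; step   = λ m → proj₁ (proj₂ (proj₂ (advance (proj₂ (orbit m)))))
            } , refl
        ; L2 = λ p _ → returns p 0 (<-wellFounded _)
        ; L3 = λ { (inj₁ ≡v) _ → ≡v
                 ; (inj₂ (t , g , refl)) tm → terminal g tm }
        }
      }
      where
      terminal : ∀ {t} → Gen t → T (term (target t)) → target t ≡ v
      terminal {t} g tm with Gen-target g
      ... | inj₁ ins = contradiction tm (inside-term i (target t) ins)
      ... | inj₂ ≡v  = ≡v

    multiStep : MultiStep D
    multiStep = record
      { n-1      = 0
      ; loop     = λ _ → loop
      ; disjoint = λ { zero zero ≢ → contradiction refl ≢ }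
      ; apart    = λ { zero zero ≢ → contradiction refl ≢ }
      }

    open MultiStep multiStep using (Removed; InBody; after)

    InBody⇒inside : ∀ {x} → InBody x → loc i x ≡ inside
    InBody⇒inside (_ , inj₁ ≡v , ≢v) = contradiction ≡v ≢v
    InBody⇒inside (_ , inj₂ (t , g , refl) , ≢v) with Gen-target g
    ... | inj₁ ins = ins
    ... | inj₂ ≡v  = contradiction ≡v ≢v

    private
      Reached : P → Set a
      Reached = Reachable {C = chart} (λ t → SubChart.Trans D t × ¬ Removed t) (SubChart.start D)

      EntriesReached : Set a
      EntriesReached = ∀ {x l y} → Step x l y → mark x y ≡ just i → Reached y

      -- Reachability without the entries of `i` is not inductive by itself, since the given path
      -- may use an entry. The second component records, once the loop has been entered, that all
      -- targets of its entries are reached otherwise.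
      Invariant : P → Set a
      Invariant x = Reached x × (loc i x ≢ outside → EntriesReached)

      extend : ∀ {x l y} → Invariant x → SubChart.Trans D (x , l , y) → Invariant y
      extend {x} {l} {y} (rx , ex) t with mark≟just x y i
      ... | yes m = ex x-in s m , λ _ → ex x-in
        where
        s : Step x l y
        s = SubChart.Trans⊆ D t
        x-in : loc i x ≢ outside
        x-in eq with trans (sym eq) (proj₁ (entry-loc x y i m))
        ... | ()
      ... | no ¬m = rx ◅◅ ((l , t , λ (_ , _ , m) → ¬m m) ◅ ε) , entered
        where
        entered : loc i y ≢ outside → EntriesReached
        entered y-in {x′} {l′} {y′} s′ m′ with loc i x in eq
        ... | root    = ex (λ ()) s′ m′
        ... | inside  = ex (λ ()) s′ m′
        ... | outside with gate i x l y x′ l′ y′ (SubChart.Trans⊆ D t) eq y-in s′ m′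
        -- Sharing its mark with the transition just taken, the duplicate is still present in `D`
        -- and is not removed now.
        ...   | k′ , s″ , same = rx ◅◅ ((k′ , keeps s″ (λ j m → kept j t (trans (sym same) m)) ,
                                       λ (_ , _ , m) → ¬m (trans (sym same) m)) ◅ ε)

      still-reached : ∀ {x y} → Invariant x →
                      Reachable {C = chart} (SubChart.Trans D) x y → Invariant y
      still-reached inv ε             = inv
      still-reached inv ((_ , t) ◅ r) = still-reached (extend inv t) r

    remains : ∀ x → SubChart.Vert after x
    remains x = vertices x , λ (r , ¬r) → ¬r (proj₁ (still-reached start-inv r))
      where
      start-inv : Invariant (SubChart.start D)
      start-inv = ε , λ ≢out → contradiction (start-outside i) ≢out

    stage-after : Stage (suc n) after
    stage-after = record
      { start-outside = start-outside
      ; vertices      = remains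
      ; keeps         = λ {x} {_} {y} s above →
          (keeps s (λ j m → <⇒≤ (above j m)) ,
           λ (_ , _ , m) → <-irrefl (sym index≡n) (above i m)) ,
          remains x , remains y
      ; kept          = λ j ((t , ¬r) , _) m →
          ≤∧≢⇒< (kept j t m) λ n≡j →
            ¬r (zero , SubChart.Trans⊆ D t ,
                trans m (cong just (index-injective (trans (sym n≡j) (sym index≡n)))))
      }

  -- `removed` counts from the current stage: the next multi-step of the run takes the loop with
  -- index `n`, hence `n + m`.
  record Outcome (n : ℕ) (D : SubChart chart) : Set (lsuc a) where
    field
      {result} : SubChart chart
      run      : Run D result
      final    : Stage loops result
      layered  : Layered run
      removed  : ∀ m x l y → RemovedAt run m (x , l , y) ⇔
                 (Step x l y × ∃[ i ] (mark x y ≡ just i × index i ≡ n + m))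

  eliminate : ∀ m {n D} → n + m ≡ loops → Stage n D → Outcome n D
  eliminate zero {n} refl stage = record
    { run     = done
    ; final   = subst (λ n → Stage n _) (sym (+-identityʳ n)) stage
    ; layered = _
    ; removed = λ m x l y → mk⇔ (λ ()) λ (_ , i , _ , eq) → contradiction
        (<-≤-trans (toℕ<n (Inverse.to enum i))
          (≤-trans (≤-reflexive (+-identityʳ n)) (≤-trans (m≤m+n n m) (≤-reflexive (sym eq)))))
        (<-irrefl refl)
    }
  eliminate (suc m) {n} {D} eq stage = record
    { run     = multiStep stage i index≡n then run
    ; final   = final
    ; layered = (λ { m (x , l , y) r b → bodies-first m r (InBody⇒inside stage i index≡n b) }) ,
                layered
    ; removed = removed′
    }
    where
    n<loops : n < loops
    n<loops = subst (n <_) eq (m<m+n n (s≤s z≤n))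
    i : Loop
    i = Inverse.from enum (fromℕ< n<loops)
    index≡n : index i ≡ n
    index≡n = trans (cong toℕ (Inverse.inverseˡ enum refl)) (toℕ-fromℕ< n<loops)
    open Outcome (eliminate m (trans (sym (+-suc n m)) eq) (stage-after stage i index≡n))
    -- Loops removed later have indices above `n`, whereas `nested` puts every loop rooted inside
    -- `i` below `n`.
    bodies-first : ∀ m {x l y} → RemovedAt run m (x , l , y) → loc i x ≢ inside
    bodies-first m {x} {l} {y} r ins
      with _ , j , mk , idx ← Equivalence.to (removed m x l y) r =
      <-irrefl refl (≤-trans (s≤s (m≤m+n n m)) (<⇒≤ (subst₂ _<_ idx index≡n
        (nested i j x ins (proj₁ (entry-loc x y j mk))))))
    removed′ : ∀ m x l y → RemovedAt (multiStep stage i index≡n then run) m (x , l , y) ⇔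
               (Step x l y × ∃[ i ] (mark x y ≡ just i × index i ≡ n + m))
    removed′ zero x l y = mk⇔
      (λ (_ , s , mk) → s , i , mk , trans index≡n (sym (+-identityʳ n)))
      λ (s , j , mk , idx) → zero , s ,
        trans mk (cong just (index-injective (trans idx (trans (+-identityʳ n) (sym index≡n)))))
    removed′ (suc m) x l y = mk⇔
      (λ r → let s , j , mk , idx = Equivalence.to (removed m x l y) r
             in s , j , mk , trans idx (sym (+-suc n m)))
      λ (s , j , mk , idx) →
        Equivalence.from (removed m x l y) (s , j , mk , trans idx (+-suc n m))

  private
    full-stage : Stage 0 (full chart)
    full-stage = record
      { start-outside = p₀-outside
      ; vertices      = _
      ; keeps         = λ s _ → s
      ; kept          = λ _ _ _ → z≤n
      }

    open Outcome (eliminate loops refl full-stage)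

    body-only : ∀ {x l y} → SubChart.Trans result (x , l , y) → mark x y ≡ nothing
    body-only {x} {l} {y} t with mark x y in eq
    ... | nothing = refl
    ... | just i  = contradiction (<-≤-trans (toℕ<n (Inverse.to enum i)) (Stage.kept final i t eq))
                      (<-irrefl refl)

    successful : ¬ InfinitePath {C = chart} (SubChart.Trans result)
    successful p = descend 0 (<-wellFounded _)
      where
      open InfinitePath p
      descend : ∀ m → ¬ Acc _<_ (rank (vertex m))
      descend m (acc rec) = descend (suc m)
        (rec (body-rank _ _ _ (SubChart.Trans⊆ result (step m)) (body-only (step m))))

    marking : P → P → ℕ
    marking x y = maybe (suc ∘ index) 0 (mark x y)

    marking≡ : ∀ x y m → (marking x y ≡ suc m) ⇔ (∃[ i ] (mark x y ≡ just i × index i ≡ m))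
    marking≡ x y m with mark x y
    ... | nothing = mk⇔ (λ ()) λ ()
    ... | just i  = mk⇔ (λ eq → i , refl , suc-injective eq) λ { (_ , refl , eq) → cong suc eq }

  witness : LLEEWitness chart
  witness = record
    { marking    = λ (x , _ , y) → marking x y
    ; run        = run
    ; successful = successful
    ; layered    = layered
    ; records    = λ {(x , l , y)} s m → mk⇔
        (λ eq → Equivalence.from (removed m x l y) (s , Equivalence.to (marking≡ x y m) eq))
        (λ r → Equivalence.from (marking≡ x y m) (proj₂ (Equivalence.to (removed m x l y) r)))
    }

  guarded : LLEEWitness.Guarded witness
  guarded {x} {l} {y} s ≢0 with mark x y in eq
  ... | nothing = contradiction refl ≢0
  ... | just i  = entry-proper x l y i s eq

-- Operations on automata

-- With one label it is the automaton of an atom; with none it serves as the fresh start vertex.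
point : List A → Graph A
point {A = A} bs = record
  { P            = ⊤
  ; size         = 1
  ; finite       = ↔-sym 1↔⊤
  ; term         = λ _ → true
  ; init         = init
  ; steps        = λ _ → []
  ; Init         = λ l q → (l , q) ∈ init
  ; Step         = λ _ _ _ → Poly.⊥
  ; init⇔        = λ _ _ → mk⇔ id id
  ; steps⇔       = λ _ _ _ → mk⇔ (λ ()) λ ()
  ; Loop         = Empty.⊥
  ; loops        = 0
  ; enum         = ↔-sym 0↔⊥
  ; mark         = λ _ _ → nothing
  ; loc          = λ ()
  ; rank         = λ _ → 0
  ; bound        = 1
  ; init-proper  = proper
  ; rank<bound   = λ _ → s≤s z≤n
  ; body-rank    = λ _ _ _ ()
  ; entry-proper = λ _ _ _ ()
  ; entry-loc    = λ _ _ ()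
  ; root-unique  = λ ()
  ; stay         = λ ()
  ; inside-term  = λ ()
  ; nested       = λ ()
  ; cycle        = λ ()
  ; init-gate    = λ ()
  ; gate         = λ ()
  }
  where
  init : List (Label A × ⊤)
  init = map (λ b → act b , tt) bs
  proper : ∀ l q → (l , q) ∈ init → Proper l
  proper l q m with b , _ , refl ← ∈-map⁻ _ m = b , refl

empty : Graph A
empty = record
  { P            = Empty.⊥
  ; size         = 0
  ; finite       = ↔-sym 0↔⊥
  ; term         = λ ()
  ; init         = []
  ; steps        = λ ()
  ; Init         = λ _ ()
  ; Step         = λ ()
  ; init⇔        = λ _ ()
  ; steps⇔       = λ ()
  ; Loop         = Empty.⊥
  ; loops        = 0
  ; enum         = ↔-sym 0↔⊥
  ; mark         = λ ()
  ; loc          = λ ()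
  ; rank         = λ ()
  ; bound        = 0
  ; init-proper  = λ _ ()
  ; rank<bound   = λ ()
  ; body-rank    = λ ()
  ; entry-proper = λ ()
  ; entry-loc    = λ ()
  ; root-unique  = λ ()
  ; stay         = λ ()
  ; inside-term  = λ ()
  ; nested       = λ ()
  ; cycle        = λ ()
  ; init-gate    = λ ()
  ; gate         = λ ()
  }

module _ {ℓ} {L : Set ℓ} {X Y : Set} where

  linked : Bool → List (L × X) → List (L × Y) → List (L × (X ⊎ Y))
  linked c ts us = map (map₂ inj₁) ts ++ (if c then map (map₂ inj₂) us else [])

  ∈-linkedˡ : ∀ c {ts us l x} → (l , inj₁ x) ∈ linked c ts us → (l , x) ∈ ts
  ∈-linkedˡ c {ts} m with ∈-++⁻ (map (map₂ inj₁) ts) m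
  ∈-linkedˡ c     m | inj₁ m′ with _ , m″ , refl ← ∈-map⁻ _ m′ = m″
  ∈-linkedˡ true  m | inj₂ m′ with _ , _ , () ← ∈-map⁻ _ m′
  ∈-linkedˡ false m | inj₂ ()

  ∈-linkedʳ : ∀ c {ts us l y} → (l , inj₂ y) ∈ linked c ts us → T c × (l , y) ∈ us
  ∈-linkedʳ c {ts} m with ∈-++⁻ (map (map₂ inj₁) ts) m
  ∈-linkedʳ c     m | inj₁ m′ with _ , _ , () ← ∈-map⁻ _ m′
  ∈-linkedʳ true  m | inj₂ m′ with _ , m″ , refl ← ∈-map⁻ _ m′ = _ , m″
  ∈-linkedʳ false m | inj₂ ()

  linked-∈ˡ : ∀ c {ts us l x} → (l , x) ∈ ts → (l , inj₁ x) ∈ linked c ts us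
  linked-∈ˡ c m = ∈-++⁺ˡ (∈-map⁺ (map₂ inj₁) m)

  linked-∈ʳ : ∀ c {ts us l y} → T c × (l , y) ∈ us → (l , inj₂ y) ∈ linked c ts us
  linked-∈ʳ true {ts} (_ , m) = ∈-++⁺ʳ (map (map₂ inj₁) ts) (∈-map⁺ (map₂ inj₂) m)

T-∧ʳ : ∀ d {c} → T (d ∧ c) → T c
T-∧ʳ true t = t

-- The positions of M followed by those of N: link tells from which positions
-- of M the initial transitions of N are available, b whether they are
-- initially. Alternatives have no links, products link where M terminates.
module Join (M N : Graph A) (b d : Bool) (link : Graph.P M → Bool)
            (link⇒term : ∀ p → T (link p) → T (Graph.term M p)) where

  private
    module M = Graph M
    module N = Graph N

  Pos Loops : Set
  Pos   = M.P ⊎ N.P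
  Loops = M.Loop ⊎ N.Loop

  term : Pos → Bool
  term (inj₁ p) = d ∧ M.term p
  term (inj₂ q) = N.term q

  steps : Pos → List (Label _ × Pos)
  steps (inj₁ p) = linked (link p) (M.steps p) N.init
  steps (inj₂ q) = map (map₂ inj₂) (N.steps q)

  Init : Label _ → Pos → Set _
  Init l (inj₁ p) = M.Init l p
  Init l (inj₂ q) = T b × N.Init l q

  Step : Pos → Label _ → Pos → Set _
  Step (inj₁ p) l (inj₁ p′) = M.Step p l p′
  Step (inj₁ p) l (inj₂ q)  = T (link p) × N.Init l q
  Step (inj₂ q) l (inj₁ p)  = Poly.⊥
  Step (inj₂ q) l (inj₂ q′) = N.Step q l q′

  init⇔ : ∀ l q → Init l q ⇔ ((l , q) ∈ linked b M.init N.init)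
  init⇔ l (inj₁ p) = mk⇔ (linked-∈ˡ b ∘ to) (from ∘ ∈-linkedˡ b)
    where open Equivalence (M.init⇔ l p)
  init⇔ l (inj₂ q) = mk⇔ (linked-∈ʳ b ∘ map₂ to) (map₂ from ∘ ∈-linkedʳ b {M.init})
    where open Equivalence (N.init⇔ l q)

  steps⇔ : ∀ p l q → Step p l q ⇔ ((l , q) ∈ steps p)
  steps⇔ (inj₁ p) l (inj₁ p′) = mk⇔ (linked-∈ˡ (link p) ∘ to) (from ∘ ∈-linkedˡ (link p))
    where open Equivalence (M.steps⇔ p l p′)
  steps⇔ (inj₁ p) l (inj₂ q) =
    mk⇔ (linked-∈ʳ (link p) ∘ map₂ to) (map₂ from ∘ ∈-linkedʳ (link p) {M.steps p})
    where open Equivalence (N.init⇔ l q)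
  steps⇔ (inj₂ q) l (inj₁ p) = mk⇔ (λ ()) absurd
    where
    absurd : (l , inj₁ p) ∈ steps (inj₂ q) → _
    absurd m with _ , _ , () ← ∈-map⁻ _ m
  steps⇔ (inj₂ q) l (inj₂ q′) = mk⇔ (∈-map⁺ (map₂ inj₂) ∘ to) (from ∘ unmap)
    where
    open Equivalence (N.steps⇔ q l q′)
    unmap : (l , inj₂ q′) ∈ steps (inj₂ q) → (l , q′) ∈ N.steps q
    unmap m with _ , m′ , refl ← ∈-map⁻ _ m = m′

  mark : Pos → Pos → Maybe Loops
  mark (inj₁ x) (inj₁ y) = Maybe.map inj₁ (M.mark x y)
  mark (inj₂ x) (inj₂ y) = Maybe.map inj₂ (N.mark x y)
  mark _        _        = nothing

  loc : Loops → Pos → Location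
  loc (inj₁ i) (inj₁ p) = M.loc i p
  loc (inj₂ i) (inj₂ q) = N.loc i q
  loc _        _        = outside

  rank : Pos → ℕ
  -- Links lead from `M` to `N` only, so lifting `M` above all of `N` makes them descend.
  rank (inj₁ p) = N.bound + M.rank p
  rank (inj₂ q) = N.rank q

  enum : Loops ↔ Fin (M.loops + N.loops)
  enum = ↔-trans (M.enum ⊎-↔ N.enum) (↔-sym +↔⊎)

  data MarkView : Pos → Pos → Loops → Set where
    left  : ∀ {x y i} → M.mark x y ≡ just i → MarkView (inj₁ x) (inj₁ y) (inj₁ i)
    right : ∀ {x y i} → N.mark x y ≡ just i → MarkView (inj₂ x) (inj₂ y) (inj₂ i)

  markView : ∀ x y i → mark x y ≡ just i → MarkView x y i
  markView (inj₁ x) (inj₁ y) i eq with M.mark x y in m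
  markView (inj₁ x) (inj₁ y) _ refl | just i = left m
  markView (inj₂ x) (inj₂ y) i eq with N.mark x y in m
  markView (inj₂ x) (inj₂ y) _ refl | just i = right m

  unmarkedˡ : ∀ x y → mark (inj₁ x) (inj₁ y) ≡ nothing → M.mark x y ≡ nothing
  unmarkedˡ x y eq with M.mark x y
  ... | nothing = refl

  unmarkedʳ : ∀ x y → mark (inj₂ x) (inj₂ y) ≡ nothing → N.mark x y ≡ nothing
  unmarkedʳ x y eq with N.mark x y
  ... | nothing = refl

  BodyStep : Pos → Pos → Set _
  BodyStep x y = ∃[ l ] (Step x l y × mark x y ≡ nothing)

  bodyˡ : ∀ {x y} → Star M.BodyStep x y → Star BodyStep (inj₁ x) (inj₁ y)
  bodyˡ = gmap inj₁ λ (l , s , m) → l , s , cong (Maybe.map inj₁) m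

  bodyʳ : ∀ {x y} → Star N.BodyStep x y → Star BodyStep (inj₂ x) (inj₂ y)
  bodyʳ = gmap inj₂ λ (l , s , m) → l , s , cong (Maybe.map inj₂) m

  init-proper : ∀ l q → Init l q → Proper l
  init-proper l (inj₁ p) s       = M.init-proper l p s
  init-proper l (inj₂ q) (_ , s) = N.init-proper l q s

  rank<bound : ∀ x → rank x < N.bound + M.bound
  rank<bound (inj₁ p) = +-monoʳ-< N.bound (M.rank<bound p)
  rank<bound (inj₂ q) = <-≤-trans (N.rank<bound q) (m≤m+n N.bound M.bound)

  body-rank : ∀ x l y → Step x l y → mark x y ≡ nothing → rank y < rank x
  body-rank (inj₁ x) l (inj₁ y) s m =
    +-monoʳ-< N.bound (M.body-rank x l y s (unmarkedˡ x y m))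
  body-rank (inj₁ x) l (inj₂ y) s m =
    <-≤-trans (N.rank<bound y) (m≤m+n N.bound (M.rank x))
  body-rank (inj₂ x) l (inj₂ y) s m = N.body-rank x l y s (unmarkedʳ x y m)

  entry-proper : ∀ x l y i → Step x l y → mark x y ≡ just i → Proper l
  entry-proper x l y i s m with markView x y i m
  ... | left m′  = M.entry-proper _ l _ _ s m′
  ... | right m′ = N.entry-proper _ l _ _ s m′

  entry-loc : ∀ x y i → mark x y ≡ just i → loc i x ≡ root × loc i y ≡ inside
  entry-loc x y i m with markView x y i m
  ... | left m′  = M.entry-loc _ _ _ m′
  ... | right m′ = N.entry-loc _ _ _ m′

  root-unique : ∀ i x y → loc i x ≡ root → loc i y ≡ root → x ≡ y
  root-unique (inj₁ i) (inj₁ x) (inj₁ y) p q = cong inj₁ (M.root-unique i x y p q)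
  root-unique (inj₂ i) (inj₂ x) (inj₂ y) p q = cong inj₂ (N.root-unique i x y p q)

  -- Links depart only from terminating vertices, and no vertex inside a loop terminates.
  stay : ∀ i x l y → Step x l y → loc i x ≡ inside → loc i y ≢ outside
  stay (inj₁ i) (inj₁ x) l (inj₁ y) s       ins = M.stay i x l y s ins
  stay (inj₁ i) (inj₁ x) l (inj₂ y) (t , _) ins =
    contradiction (link⇒term x t) (M.inside-term i x ins)
  stay (inj₂ i) (inj₂ x) l (inj₂ y) s       ins = N.stay i x l y s ins

  inside-term : ∀ i x → loc i x ≡ inside → ¬ T (term x)
  inside-term (inj₁ i) (inj₁ x) ins t = M.inside-term i x ins (T-∧ʳ d t)
  inside-term (inj₂ i) (inj₂ x) ins   = N.inside-term i x ins

  nested : ∀ i j x → loc i x ≡ inside → loc j x ≡ root →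
           toℕ (Inverse.to enum j) < toℕ (Inverse.to enum i)
  nested (inj₁ i) (inj₁ j) (inj₁ x) p q =
    subst₂ _<_ (sym (toℕ-↑ˡ (Inverse.to M.enum j) N.loops))
               (sym (toℕ-↑ˡ (Inverse.to M.enum i) N.loops)) (M.nested i j x p q)
  nested (inj₂ i) (inj₂ j) (inj₂ x) p q =
    subst₂ _<_ (sym (toℕ-↑ʳ M.loops (Inverse.to N.enum j)))
               (sym (toℕ-↑ʳ M.loops (Inverse.to N.enum i))) (+-monoʳ-< M.loops (N.nested i j x p q))

  cycle : ∀ i → ∃[ x ] ∃[ l ] ∃[ y ] (Step x l y × mark x y ≡ just i × Star BodyStep y x)
  cycle (inj₁ i) with x , l , y , s , m , p ← M.cycle i =
    inj₁ x , l , inj₁ y , s , cong (Maybe.map inj₁) m , bodyˡ p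
  cycle (inj₂ i) with x , l , y , s , m , p ← N.cycle i =
    inj₂ x , l , inj₂ y , s , cong (Maybe.map inj₂) m , bodyʳ p

  init-gate : ∀ i l q x k y → Init l q → loc i q ≢ outside →
              Step x k y → mark x y ≡ just i → ∃[ k′ ] Init k′ y
  init-gate i l q x k y _ _ _ m with markView x y i m
  init-gate _ l (inj₁ q) _ k _ s ≢out e _ | left m =
    M.init-gate _ l q _ k _ s ≢out e m
  init-gate _ l (inj₂ q) _ k _ _ ≢out _ _ | left _ = contradiction refl ≢out
  init-gate _ l (inj₁ q) _ k _ _ ≢out _ _ | right _ = contradiction refl ≢out
  init-gate _ l (inj₂ q) _ k _ (t , s) ≢out e _ | right m =
    map₂ (t ,_) (N.init-gate _ l q _ k _ s ≢out e m)

  gate : ∀ i z l q x k y → Step z l q → loc i z ≡ outside → loc i q ≢ outside →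
         Step x k y → mark x y ≡ just i → ∃[ k′ ] (Step z k′ y × mark z y ≡ mark z q)
  gate i z l q x k y _ _ _ _ m with markView x y i m
  gate _ (inj₁ z) l (inj₁ q) _ k _ s out ≢out e _ | left m
    with k′ , s′ , same ← M.gate _ z l q _ k _ s out ≢out e m =
    k′ , s′ , cong (Maybe.map inj₁) same
  gate _ (inj₁ z) l (inj₂ q) _ k _ s out ≢out e _ | left m = contradiction refl ≢out
  gate _ (inj₂ z) l (inj₂ q) _ k _ s out ≢out e _ | left m = contradiction refl ≢out
  gate _ (inj₁ z) l (inj₁ q) _ k _ s out ≢out e _ | right m = contradiction refl ≢out
  -- All transitions across the link are unmarked, so the marks agree by `refl`.
  gate _ (inj₁ z) l (inj₂ q) _ k _ (t , s) out ≢out e _ | right m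
    with k′ , s′ ← N.init-gate _ l q _ k _ s ≢out e m = k′ , (t , s′) , refl
  gate _ (inj₂ z) l (inj₂ q) _ k _ s out ≢out e _ | right m
    with k′ , s′ , same ← N.gate _ z l q _ k _ s out ≢out e m =
    k′ , s′ , cong (Maybe.map inj₂) same

  graph : Graph _
  graph = record
    { P            = Pos
    ; size         = M.size + N.size
    ; finite       = ↔-trans (M.finite ⊎-↔ N.finite) (↔-sym +↔⊎)
    ; term         = term
    ; init         = linked b M.init N.init
    ; steps        = steps
    ; Init         = Init
    ; Step         = Step
    ; init⇔        = init⇔
    ; steps⇔       = steps⇔
    ; Loop         = Loops
    ; loops        = M.loops + N.loops
    ; enum         = enum
    ; mark         = mark
    ; loc          = loc
    ; rank         = rank
    ; bound        = N.bound + M.bound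
    ; init-proper  = init-proper
    ; rank<bound   = rank<bound
    ; body-rank    = body-rank
    ; entry-proper = entry-proper
    ; entry-loc    = entry-loc
    ; root-unique  = root-unique
    ; stay         = stay
    ; inside-term  = inside-term
    ; nested       = nested
    ; cycle        = cycle
    ; init-gate    = init-gate
    ; gate         = gate
    }

alt : Graph A → Graph A → Graph A
alt M N = Join.graph M N true true (λ _ → false) (λ _ ())

-- b and d tell whether the first and the second factor terminate immediately.
seq : Bool → Bool → Graph A → Graph A → Graph A
seq b d M N = Join.graph M N b d (Graph.term M) (λ _ → id)

-- The vertex added by an iteration has the initial transitions as loop-entry
-- transitions; termination in M becomes a 1-transition back to it.
module Iterate (M : Graph A) (exit : Graph.ExitPath M) where

  private
    module M = Graph M

  Pos Loops : Set
  Pos   = M.P ⊎ ⊤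
  Loops = M.Loop ⊎ ⊤

  term : Pos → Bool
  term (inj₁ p) = false
  term (inj₂ _) = true

  init : List (Label _ × Pos)
  init = linked false M.init []

  steps : Pos → List (Label _ × Pos)
  steps (inj₁ p) = linked (M.term p) (M.steps p) ((𝟏 , tt) ∷ [])
  steps (inj₂ _) = init

  Init : Label _ → Pos → Set _
  Init l (inj₁ p) = M.Init l p
  Init l (inj₂ _) = Poly.⊥

  Step : Pos → Label _ → Pos → Set _
  Step (inj₁ p) l (inj₁ p′) = M.Step p l p′
  Step (inj₁ p) l (inj₂ _)  = T (M.term p) × (l , tt) ∈ ((𝟏 , tt) ∷ [])
  Step (inj₂ _) l q         = Init l q

  init⇔ : ∀ l q → Init l q ⇔ ((l , q) ∈ init)
  init⇔ l (inj₁ p) = mk⇔ (linked-∈ˡ false {us = []} ∘ to) (from ∘ ∈-linkedˡ false {us = []})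
    where open Equivalence (M.init⇔ l p)
  init⇔ l (inj₂ _) = mk⇔ (λ ()) λ m → contradiction (proj₁ (∈-linkedʳ false {M.init} {[]} m)) id

  steps⇔ : ∀ p l q → Step p l q ⇔ ((l , q) ∈ steps p)
  steps⇔ (inj₁ p) l (inj₁ p′) =
    mk⇔ (linked-∈ˡ (M.term p) ∘ to) (from ∘ ∈-linkedˡ (M.term p))
    where open Equivalence (M.steps⇔ p l p′)
  steps⇔ (inj₁ p) l (inj₂ _) =
    mk⇔ (linked-∈ʳ (M.term p)) (∈-linkedʳ (M.term p) {M.steps p})
  steps⇔ (inj₂ _) l q = init⇔ l q

  mark : Pos → Pos → Maybe Loops
  mark (inj₁ x) (inj₁ y) = Maybe.map inj₁ (M.mark x y)
  mark (inj₂ _) (inj₁ y) = just (inj₂ tt)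
  mark _        (inj₂ _) = nothing

  loc : Loops → Pos → Location
  loc (inj₁ i) (inj₁ p) = M.loc i p
  loc (inj₁ i) (inj₂ _) = outside
  loc (inj₂ _) (inj₁ _) = inside
  loc (inj₂ _) (inj₂ _) = root

  rank : Pos → ℕ
  rank (inj₁ p) = suc (M.rank p)
  -- All transitions from the star vertex are loop entries, so no body transition has to descend
  -- from it.
  rank (inj₂ _) = 0

  enum : Loops ↔ Fin (M.loops + 1)
  enum = ↔-trans (M.enum ⊎-↔ ↔-sym 1↔⊤) (↔-sym +↔⊎)

  data MarkView : Pos → Pos → Loops → Set where
    inner : ∀ {x y i} → M.mark x y ≡ just i → MarkView (inj₁ x) (inj₁ y) (inj₁ i)
    outer : ∀ {y} → MarkView (inj₂ tt) (inj₁ y) (inj₂ tt)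

  markView : ∀ x y i → mark x y ≡ just i → MarkView x y i
  markView (inj₁ x) (inj₁ y) i eq with M.mark x y in m
  markView (inj₁ x) (inj₁ y) _ refl | just i = inner m
  markView (inj₂ _) (inj₁ y) _ refl = outer

  unmarked : ∀ x y → mark (inj₁ x) (inj₁ y) ≡ nothing → M.mark x y ≡ nothing
  unmarked x y eq with M.mark x y
  ... | nothing = refl

  BodyStep : Pos → Pos → Set _
  BodyStep x y = ∃[ l ] (Step x l y × mark x y ≡ nothing)

  body : ∀ {x y} → Star M.BodyStep x y → Star BodyStep (inj₁ x) (inj₁ y)
  body = gmap inj₁ λ (l , s , m) → l , s , cong (Maybe.map inj₁) m

  -- The exit path is prolonged by the new 1-transition. It closes the cycle of the new loop and, as
  -- the star vertex terminates, is also the exit path of the iteration.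
  return : ∃[ l ] ∃[ y ] (Init l y × Star BodyStep y (inj₂ tt))
  return = let l , y , z , s , p , t = exit
          in l , inj₁ y , s , body p ◅◅ ((𝟏 , (t , here refl) , refl) ◅ ε)

  init-proper : ∀ l q → Init l q → Proper l
  init-proper l (inj₁ p) s = M.init-proper l p s

  rank<bound : ∀ x → rank x < suc M.bound
  rank<bound (inj₁ p) = s≤s (M.rank<bound p)
  rank<bound (inj₂ _) = s≤s z≤n

  body-rank : ∀ x l y → Step x l y → mark x y ≡ nothing → rank y < rank x
  body-rank (inj₁ x) l (inj₁ y) s m = s≤s (M.body-rank x l y s (unmarked x y m))
  body-rank (inj₁ x) l (inj₂ _) s m = s≤s z≤n

  entry-proper : ∀ x l y i → Step x l y → mark x y ≡ just i → Proper l
  entry-proper x l y i s m with markView x y i m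
  ... | inner m′ = M.entry-proper _ l _ _ s m′
  ... | outer    = M.init-proper l _ s

  entry-loc : ∀ x y i → mark x y ≡ just i → loc i x ≡ root × loc i y ≡ inside
  entry-loc x y i m with markView x y i m
  ... | inner m′ = M.entry-loc _ _ _ m′
  ... | outer    = refl , refl

  root-unique : ∀ i x y → loc i x ≡ root → loc i y ≡ root → x ≡ y
  root-unique (inj₁ i) (inj₁ x) (inj₁ y) p q = cong inj₁ (M.root-unique i x y p q)
  root-unique (inj₂ _) (inj₂ _) (inj₂ _) p q = refl

  stay : ∀ i x l y → Step x l y → loc i x ≡ inside → loc i y ≢ outside
  stay (inj₁ i) (inj₁ x) l (inj₁ y) s       ins = M.stay i x l y s ins
  stay (inj₁ i) (inj₁ x) l (inj₂ _) (t , _) ins = contradiction t (M.inside-term i x ins)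
  stay (inj₂ _) (inj₁ x) l (inj₁ y) s       ins = λ ()
  stay (inj₂ _) (inj₁ x) l (inj₂ _) s       ins = λ ()

  inside-term : ∀ i x → loc i x ≡ inside → ¬ T (term x)
  inside-term _        (inj₁ x) _ = id
  inside-term (inj₁ i) (inj₂ _) ()
  inside-term (inj₂ _) (inj₂ _) ()

  nested : ∀ i j x → loc i x ≡ inside → loc j x ≡ root →
           toℕ (Inverse.to enum j) < toℕ (Inverse.to enum i)
  nested (inj₁ i) (inj₁ j) (inj₁ x) p q =
    subst₂ _<_ (sym (toℕ-↑ˡ (Inverse.to M.enum j) 1))
               (sym (toℕ-↑ˡ (Inverse.to M.enum i) 1)) (M.nested i j x p q)
  nested (inj₂ _) (inj₁ j) (inj₁ x) p q =
    subst₂ _<_ (sym (toℕ-↑ˡ (Inverse.to M.enum j) 1))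
               (sym (trans (toℕ-↑ʳ M.loops zero) (+-identityʳ M.loops))) (toℕ<n (Inverse.to M.enum j))
  nested (inj₁ _) (inj₂ _) (inj₂ _) () _
  nested (inj₂ _) (inj₂ _) (inj₂ _) () _

  cycle : ∀ i → ∃[ x ] ∃[ l ] ∃[ y ] (Step x l y × mark x y ≡ just i × Star BodyStep y x)
  cycle (inj₁ i) with x , l , y , s , m , p ← M.cycle i =
    inj₁ x , l , inj₁ y , s , cong (Maybe.map inj₁) m , body p
  cycle (inj₂ _) with l , inj₁ y , s , p ← return = inj₂ tt , l , inj₁ y , s , refl , p

  init-gate : ∀ i l q x k y → Init l q → loc i q ≢ outside →
              Step x k y → mark x y ≡ just i → ∃[ k′ ] Init k′ y
  init-gate i l q x k y _ _ _ m with markView x y i m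
  init-gate _ l (inj₁ q) _ k _ s ≢out e _ | inner m = M.init-gate _ l q _ k _ s ≢out e m
  -- `Step` from the star vertex unfolds to `Init`, so the entry itself is the required initial
  -- transition.
  init-gate _ l (inj₁ q) _ k _ s ≢out e _ | outer   = k , e

  gate : ∀ i z l q x k y → Step z l q → loc i z ≡ outside → loc i q ≢ outside →
         Step x k y → mark x y ≡ just i → ∃[ k′ ] (Step z k′ y × mark z y ≡ mark z q)
  gate i z l q x k y _ _ _ _ m with markView x y i m
  gate _ (inj₁ z) l (inj₁ q) _ k _ s out ≢out e _ | inner m
    with k′ , s′ , same ← M.gate _ z l q _ k _ s out ≢out e m =
    k′ , s′ , cong (Maybe.map inj₁) same
  gate _ (inj₁ z) l (inj₂ q) _ k _ s out ≢out e _ | inner m = contradiction refl ≢out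
  gate _ (inj₂ z) l (inj₁ q) _ k _ s out ≢out e _ | inner m
    with k′ , s′ ← M.init-gate _ l q _ k _ s ≢out e m = k′ , s′ , refl
  gate _ (inj₁ z) l q _ k _ s () ≢out e _ | outer
  gate _ (inj₂ z) l q _ k _ s () ≢out e _ | outer

  graph : Graph _
  graph = record
    { P            = Pos
    ; size         = M.size + 1
    ; finite       = ↔-trans (M.finite ⊎-↔ ↔-sym 1↔⊤) (↔-sym +↔⊎)
    ; term         = term
    ; init         = init
    ; steps        = steps
    ; Init         = Init
    ; Step         = Step
    ; init⇔        = init⇔
    ; steps⇔       = steps⇔
    ; Loop         = Loops
    ; loops        = M.loops + 1
    ; enum         = enum
    ; mark         = mark
    ; loc          = loc
    ; rank         = rank
    ; bound        = suc M.bound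
    ; init-proper  = init-proper
    ; rank<bound   = rank<bound
    ; body-rank    = body-rank
    ; entry-proper = entry-proper
    ; entry-loc    = entry-loc
    ; root-unique  = root-unique
    ; stay         = stay
    ; inside-term  = inside-term
    ; nested       = nested
    ; cycle        = cycle
    ; init-gate    = init-gate
    ; gate         = gate
    }

-- Provable equality and solutions

module _ {A : Set a} {S : Rules A ℓ₁} {S′ : Rules A ℓ₂}
         (simulate : ∀ {Ps E} → S Ps E → All (S′ ⊢_) Ps → S′ ⊢ E) where

  mutual
    translate : ∀ {E} → S ⊢ E → S′ ⊢ E
    translate (by r ds) = simulate r (translate-all ds)

    translate-all : ∀ {Ps} → All (S ⊢_) Ps → All (S′ ⊢_) Ps
    translate-all []       = []
    translate-all (d ∷ ds) = translate d ∷ translate-all ds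

τ : Bool → StExp A
τ b = if b then 𝟙 else 𝟘

sum : {P : Set} → (P → StExp A) → List (Label A × P) → StExp A
sum s ts = ∑ (map (λ t → ⌊ proj₁ t ⌋ ⊙ s (proj₂ t)) ts)

sum-map : {P Q : Set} (s : Q → StExp A) (h : P → Q) (ts : List (Label A × P)) →
          sum s (map (map₂ h) ts) ≡ sum (s ∘ h) ts
sum-map s h ts = cong ∑ (sym (map-∘ ts))

-- The system is a parameter because three occur: `Mil⁻` for interpretations, `Mil⁻` with the
-- premise for solutions, and `cMil₁` for dead bodies.
module Provable {A : Set a} {S : Rules A ℓ} (Mil⁻⊆S : ∀ {Ps E} → Mil⁻ Ps E → S Ps E) where

  infix 4 _≈_

  _≈_ : StExp A → StExp A → Set (a ⊔ ℓ)
  e ≈ f = S ⊢ (e ≐ f)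

  setoid : Setoid a (a ⊔ ℓ)
  setoid = record
    { Carrier       = StExp A
    ; _≈_           = _≈_
    ; isEquivalence = record
      { refl  = by (Mil⁻⊆S (inj₁ reflexivity)) []
      ; sym   = λ p → by (Mil⁻⊆S (inj₁ symmetry)) (p ∷ [])
      ; trans = λ p q → by (Mil⁻⊆S (inj₁ transitivity)) (p ∷ q ∷ [])
      }
    }

  open Setoid setoid public using ()
    renaming (refl to ≈-refl; sym to ≈-sym; trans to ≈-trans; reflexive to ≈-reflexive)
  open SetoidReasoning setoid

  ax : ∀ {E} → MilAxiom E → S ⊢ E
  ax m = by (Mil⁻⊆S (inj₂ (axiom m))) []

  in-context : ∀ {e f} (C : Context A) → e ≈ f → plug C e ≈ plug C f
  in-context C p = by (Mil⁻⊆S (inj₁ (context C))) (p ∷ [])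

  ⊕-cong : ∀ {e e′ f f′} → e ≈ e′ → f ≈ f′ → e ⊕ f ≈ e′ ⊕ f′
  ⊕-cong p q = ≈-trans (in-context (□ ·⊕ _) p) (in-context (_ ⊕· □) q)

  ⊙-cong : ∀ {e e′ f f′} → e ≈ e′ → f ≈ f′ → e ⊙ f ≈ e′ ⊙ f′
  ⊙-cong p q = ≈-trans (in-context (□ ·⊙ _) p) (in-context (_ ⊙· □) q)

  *-cong : ∀ {e f} → e ≈ f → e * ≈ f *
  *-cong = in-context (□ ·*)

  ⊕-identityˡ : ∀ e → 𝟘 ⊕ e ≈ e
  ⊕-identityˡ e = ≈-trans (ax ⊕-comm) (ax ⊕-neutral)

  ⊕-commutativeMonoid : CommutativeMonoid a (a ⊔ ℓ)
  ⊕-commutativeMonoid = record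
    { Carrier             = StExp A
    ; _≈_                 = _≈_
    ; _∙_                 = _⊕_
    ; ε                   = 𝟘
    ; isCommutativeMonoid = record
      { isMonoid = record
        { isSemigroup = record
          { isMagma = record
            { isEquivalence = Setoid.isEquivalence setoid
            ; ∙-cong        = ⊕-cong
            }
          ; assoc = λ _ _ _ → ax ⊕-assoc
          }
        ; identity = ⊕-identityˡ , λ _ → ax ⊕-neutral
        }
      ; comm = λ _ _ → ax ⊕-comm
      }
    }

  open CommutativeSemigroupProperties (CommutativeMonoid.commutativeSemigroup ⊕-commutativeMonoid)
    using (interchange; xy∙z≈x∙zy)

  τ-∨ : ∀ b d → τ b ⊕ τ d ≈ τ (b ∨ d)
  τ-∨ true  true  = ax ⊕-idem
  τ-∨ true  false = ax ⊕-neutral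
  τ-∨ false d     = ⊕-identityˡ _

  -- The sum associates to the left, so the induction absorbs the next summand into the head.
  ∑-∷ : ∀ e es → ∑ (e ∷ es) ≈ e ⊕ ∑ es
  ∑-∷ e []       = ≈-sym (ax ⊕-neutral)
  ∑-∷ e (f ∷ es) = begin
    ∑ (e ⊕ f ∷ es)     ≈⟨ ∑-∷ (e ⊕ f) es ⟩
    e ⊕ f ⊕ ∑ es       ≈⟨ ax ⊕-assoc ⟩
    e ⊕ (f ⊕ ∑ es)     ≈⟨ ⊕-cong ≈-refl (∑-∷ f es) ⟨
    e ⊕ ∑ (f ∷ es)     ∎

  module _ {P : Set} where

    sum-∷ : ∀ (s : P → StExp A) l q ts → sum s ((l , q) ∷ ts) ≈ ⌊ l ⌋ ⊙ s q ⊕ sum s ts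
    sum-∷ s l q ts = ∑-∷ (⌊ l ⌋ ⊙ s q) (map (λ t → ⌊ proj₁ t ⌋ ⊙ s (proj₂ t)) ts)

    sum-++ : ∀ (s : P → StExp A) ts us → sum s (ts ++ us) ≈ sum s ts ⊕ sum s us
    sum-++ s []             us = ≈-sym (⊕-identityˡ _)
    sum-++ s ((l , q) ∷ ts) us = begin
      sum s ((l , q) ∷ ts ++ us)               ≈⟨ sum-∷ s l q (ts ++ us) ⟩
      ⌊ l ⌋ ⊙ s q ⊕ sum s (ts ++ us)           ≈⟨ ⊕-cong ≈-refl (sum-++ s ts us) ⟩
      ⌊ l ⌋ ⊙ s q ⊕ (sum s ts ⊕ sum s us)      ≈⟨ ax ⊕-assoc ⟨
      ⌊ l ⌋ ⊙ s q ⊕ sum s ts ⊕ sum s us        ≈⟨ ⊕-cong (sum-∷ s l q ts) ≈-refl ⟨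
      sum s ((l , q) ∷ ts) ⊕ sum s us          ∎

    sum-⊙ : ∀ (s : P → StExp A) ts e → sum s ts ⊙ e ≈ sum (λ q → s q ⊙ e) ts
    sum-⊙ s []             e = ax deadlock
    sum-⊙ s ((l , q) ∷ ts) e = begin
      sum s ((l , q) ∷ ts) ⊙ e                          ≈⟨ ⊙-cong (sum-∷ s l q ts) ≈-refl ⟩
      (⌊ l ⌋ ⊙ s q ⊕ sum s ts) ⊙ e                      ≈⟨ ax r-distr ⟩
      ⌊ l ⌋ ⊙ s q ⊙ e ⊕ sum s ts ⊙ e                    ≈⟨ ⊕-cong (ax ⊙-assoc) (sum-⊙ s ts e) ⟩
      ⌊ l ⌋ ⊙ (s q ⊙ e) ⊕ sum (λ q → s q ⊙ e) ts        ≈⟨ sum-∷ _ l q ts ⟨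
      sum (λ q → s q ⊙ e) ((l , q) ∷ ts)                ∎

    τ-sum-⊙ : ∀ {x} b (s : P → StExp A) ts y → x ≈ τ b ⊕ sum s ts →
              x ⊙ y ≈ (if b then y else 𝟘) ⊕ sum (λ q → s q ⊙ y) ts
    τ-sum-⊙ {x} b s ts y p = begin
      x ⊙ y                                          ≈⟨ ⊙-cong p ≈-refl ⟩
      (τ b ⊕ sum s ts) ⊙ y                           ≈⟨ ax r-distr ⟩
      τ b ⊙ y ⊕ sum s ts ⊙ y                         ≈⟨ ⊕-cong (τ-⊙ b) (sum-⊙ s ts y) ⟩
      (if b then y else 𝟘) ⊕ sum (λ q → s q ⊙ y) ts  ∎
      where
      τ-⊙ : ∀ b → τ b ⊙ y ≈ (if b then y else 𝟘)
      τ-⊙ true  = ax ⊙-idˡ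
      τ-⊙ false = ax deadlock

  module _ {P Q : Set} where

    sum-linked : ∀ (s : P ⊎ Q → StExp A) c ts us →
                 sum s (linked c ts us) ≈ sum (s ∘ inj₁) ts ⊕ (if c then sum (s ∘ inj₂) us else 𝟘)
    sum-linked s c ts us = ≈-trans (sum-++ s (map (map₂ inj₁) ts) _)
      (⊕-cong (≈-reflexive (sum-map s inj₁ ts)) (linked-part c))
      where
      linked-part : ∀ c → sum s (if c then map (map₂ inj₂) us else []) ≈
                          (if c then sum (s ∘ inj₂) us else 𝟘)
      linked-part true  = ≈-reflexive (sum-map s inj₂ us)
      linked-part false = ≈-refl

    -- This is sequential composition in equational form: `c` says whether `x` may go on as `y`.
    -- Products, returns from a star body and the fresh start vertex are all instances.
    link : ∀ (s : P ⊎ Q → StExp A) c d ts us {x y} →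
           x ≈ (if c then y else 𝟘) ⊕ sum (s ∘ inj₁) ts →
           y ≈ τ d ⊕ sum (s ∘ inj₂) us →
           x ≈ τ (d ∧ c) ⊕ sum s (linked c ts us)
    link s c d ts us {x} {y} p q = begin
      x                                                       ≈⟨ p ⟩
      (if c then y else 𝟘) ⊕ sum (s ∘ inj₁) ts                ≈⟨ ⊕-cong (split c d q) ≈-refl ⟩
      τ (d ∧ c) ⊕ (if c then sum (s ∘ inj₂) us else 𝟘) ⊕ sum (s ∘ inj₁) ts
                                                              ≈⟨ xy∙z≈x∙zy _ _ _ ⟩
      τ (d ∧ c) ⊕ (sum (s ∘ inj₁) ts ⊕ (if c then sum (s ∘ inj₂) us else 𝟘))
                                                              ≈⟨ ⊕-cong ≈-refl (sum-linked s c ts us) ⟨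
      τ (d ∧ c) ⊕ sum s (linked c ts us)                      ∎
      where
      split : ∀ c d {z} → y ≈ τ d ⊕ z →
              (if c then y else 𝟘) ≈ τ (d ∧ c) ⊕ (if c then z else 𝟘)
      split true  true  q = q
      split true  false q = q
      split false true  q = ≈-sym (ax ⊕-neutral)
      split false false q = ≈-sym (ax ⊕-neutral)

  -- Solutions of composed automata

  Solves : (G : Graph A) → (Graph.P G → StExp A) → Set (a ⊔ ℓ)
  Solves G s = ∀ p → s p ≈ τ (Graph.term G p) ⊕ sum s (Graph.steps G p)

  SolvesInit : (G : Graph A) → Bool → StExp A → (Graph.P G → StExp A) → Set (a ⊔ ℓ)
  SolvesInit G b x s = x ≈ τ b ⊕ sum s (Graph.init G)

  -- Terminating positions continue with y.
  SolvesBefore : (M : Graph A) → StExp A → (Graph.P M → StExp A) → Set (a ⊔ ℓ)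
  SolvesBefore M y s =
    ∀ p → s p ≈ (if Graph.term M p then y else 𝟘) ⊕ sum s (Graph.steps M p)

  ⊙-before : ∀ {M s} y → Solves M s → SolvesBefore M y (λ p → s p ⊙ y)
  ⊙-before {M} {s} y sol p = τ-sum-⊙ (Graph.term M p) s (Graph.steps M p) y (sol p)

  seq-solves : ∀ {M N b d y s t} → SolvesBefore M y s → SolvesInit N d y t → Solves N t →
               Solves (seq b d M N) [ s , t ]′
  seq-solves {M} {N} {b} {d} {y} {s} {t} sM iN sN (inj₁ p) =
    link [ s , t ]′ (Graph.term M p) d (Graph.steps M p) (Graph.init N) (sM p) iN
  seq-solves {M} {N} {b} {d} {y} {s} {t} sM iN sN (inj₂ q) =
    ≈-trans (sN q) (⊕-cong ≈-refl (≈-reflexive (sym (sum-map [ s , t ]′ inj₂ (Graph.steps N q)))))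

  iterate-inner : ∀ {M s} exit x → Solves M s → ∀ p →
    s p ⊙ x ≈ 𝟘 ⊕ sum [ (λ p → s p ⊙ x) , const x ]′ (Iterate.steps M exit (inj₁ p))
  iterate-inner {M} {s} exit x sol p =
    link [ (λ p → s p ⊙ x) , const x ]′ (Graph.term M p) false (Graph.steps M p) ((𝟏 , tt) ∷ [])
      (⊙-before {M} x sol p) (≈-sym (≈-trans (⊕-identityˡ _) (ax ⊙-idˡ)))

  iterate-init : ∀ {M : Graph A} {x y z} {s : Graph.P M → StExp A} exit →
    y ≈ z ⊕ sum (λ p → s p ⊙ x) (Graph.init M) →
    y ≈ z ⊕ sum [ (λ p → s p ⊙ x) , const x ]′ (Iterate.init M exit)
  iterate-init {M} {x} {y} {z} {s} exit p = ≈-trans p (⊕-cong ≈-refl (≈-sym (≈-trans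
    (sum-linked [ (λ p → s p ⊙ x) , const x ]′ false (Graph.init M) []) (ax ⊕-neutral))))

  alt-init : ∀ {M N b d x y s t} → SolvesInit M b x s → SolvesInit N d y t →
             SolvesInit (alt M N) (b ∨ d) (x ⊕ y) [ s , t ]′
  alt-init {M} {N} {b} {d} {x} {y} {s} {t} iM iN = begin
    x ⊕ y                                                   ≈⟨ ⊕-cong iM iN ⟩
    (τ b ⊕ sum s (Graph.init M)) ⊕ (τ d ⊕ sum t (Graph.init N))  ≈⟨ interchange _ _ _ _ ⟩
    (τ b ⊕ τ d) ⊕ (sum s (Graph.init M) ⊕ sum t (Graph.init N))
                  ≈⟨ ⊕-cong (τ-∨ b d) (≈-sym (sum-linked [ s , t ]′ true (Graph.init M) (Graph.init N))) ⟩
    τ (b ∨ d) ⊕ sum [ s , t ]′ (Graph.init (alt M N))        ∎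

  alt-solves : ∀ {M N s t} → Solves M s → Solves N t → Solves (alt M N) [ s , t ]′
  alt-solves {M} {N} {s} {t} sM sN (inj₁ p) = ≈-trans (sM p) (⊕-cong ≈-refl (≈-sym (≈-trans
    (sum-linked [ s , t ]′ false (Graph.steps M p) (Graph.init N)) (ax ⊕-neutral))))
  alt-solves {M} {N} {s} {t} sM sN (inj₂ q) =
    ≈-trans (sN q) (⊕-cong ≈-refl (≈-reflexive (sym (sum-map [ s , t ]′ inj₂ (Graph.steps N q)))))

  -- Unfolding of stars, and dead expressions

  *-drop-τ : ∀ b e → (τ b ⊕ e) * ≈ e *
  *-drop-τ true  e = ≈-sym (ax *-trm)
  *-drop-τ false e = *-cong (⊕-identityˡ e)

  -- Unfolding by `*-rec` directly would leave a bare summand `e *` when `b` is true; `*-trm` drops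
  -- the termination of the body beforehand.
  *-unfold : ∀ {e} b f → e ≈ τ b ⊕ f → e * ≈ 𝟙 ⊕ f ⊙ e *
  *-unfold {e} b f p = begin
    e *              ≈⟨ e*≈f* ⟩
    f *              ≈⟨ ax *-rec ⟩
    𝟙 ⊕ f ⊙ f *      ≈⟨ ⊕-cong ≈-refl (⊙-cong ≈-refl e*≈f*) ⟨
    𝟙 ⊕ f ⊙ e *      ∎
    where
    e*≈f* : e * ≈ f *
    e*≈f* = ≈-trans (*-cong p) (*-drop-τ b f)

  *-⊙-unfold : ∀ f g → f * ⊙ g ≈ f ⊙ (f * ⊙ g) ⊕ g
  *-⊙-unfold f g = begin
    f * ⊙ g                   ≈⟨ ⊙-cong (ax *-rec) ≈-refl ⟩
    (𝟙 ⊕ f ⊙ f *) ⊙ g         ≈⟨ ax r-distr ⟩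
    𝟙 ⊙ g ⊕ f ⊙ f * ⊙ g       ≈⟨ ⊕-cong (ax ⊙-idˡ) (ax ⊙-assoc) ⟩
    g ⊕ f ⊙ (f * ⊙ g)         ≈⟨ ax ⊕-comm ⟩
    f ⊙ (f * ⊙ g) ⊕ g         ∎

  -- A proper step of e never leads to termination.
  Dead : Bool → StExp A → Set (a ⊔ ℓ)
  Dead b e = e ≈ τ b ⊕ e ⊙ 𝟘

  ⊙𝟘⊙ : ∀ e f → e ⊙ 𝟘 ⊙ f ≈ e ⊙ 𝟘
  ⊙𝟘⊙ e f = ≈-trans (ax ⊙-assoc) (⊙-cong ≈-refl (ax deadlock))

  dead-⊙ : ∀ {e} f → Dead false e → e ⊙ f ≈ e
  dead-⊙ {e} f p = begin
    e ⊙ f      ≈⟨ ⊙-cong e≈e𝟘 ≈-refl ⟩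
    e ⊙ 𝟘 ⊙ f  ≈⟨ ⊙𝟘⊙ e f ⟩
    e ⊙ 𝟘      ≈⟨ e≈e𝟘 ⟨
    e          ∎
    where
    e≈e𝟘 : e ≈ e ⊙ 𝟘
    e≈e𝟘 = ≈-trans p (⊕-identityˡ _)

  Dead-⊕ : ∀ {b d e f} → Dead b e → Dead d f → Dead (b ∨ d) (e ⊕ f)
  Dead-⊕ {b} {d} {e} {f} p q = begin
    e ⊕ f                              ≈⟨ ⊕-cong p q ⟩
    (τ b ⊕ e ⊙ 𝟘) ⊕ (τ d ⊕ f ⊙ 𝟘)      ≈⟨ interchange _ _ _ _ ⟩
    (τ b ⊕ τ d) ⊕ (e ⊙ 𝟘 ⊕ f ⊙ 𝟘)      ≈⟨ ⊕-cong (τ-∨ b d) (≈-sym (ax r-distr)) ⟩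
    τ (b ∨ d) ⊕ (e ⊕ f) ⊙ 𝟘            ∎

  Dead-⊙ʳ : ∀ {f} e → Dead false f → Dead false (e ⊙ f)
  Dead-⊙ʳ {f} e q = begin
    e ⊙ f            ≈⟨ ⊙-cong ≈-refl (dead-⊙ 𝟘 q) ⟨
    e ⊙ (f ⊙ 𝟘)      ≈⟨ ax ⊙-assoc ⟨
    e ⊙ f ⊙ 𝟘        ≈⟨ ⊕-identityˡ _ ⟨
    𝟘 ⊕ e ⊙ f ⊙ 𝟘    ∎

  Dead-⊙ˡ : ∀ {e} f → Dead false e → Dead false (e ⊙ f)
  Dead-⊙ˡ {e} f p = begin
    e ⊙ f            ≈⟨ dead-⊙ f p ⟩
    e                ≈⟨ p ⟩
    𝟘 ⊕ e ⊙ 𝟘        ≈⟨ ⊕-cong ≈-refl (⊙-cong (dead-⊙ f p) ≈-refl) ⟨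
    𝟘 ⊕ e ⊙ f ⊙ 𝟘    ∎

  -- From `e ≈ 𝟙 ⊕ e ⊙ 𝟘` follows `e ⊙ g ≈ g ⊕ e ⊙ 𝟘` for every `g`; this is used for `f` and for
  -- `f ⊙ 𝟘`.
  Dead-⊙ : ∀ {d e f} → Dead true e → Dead d f → Dead d (e ⊙ f)
  Dead-⊙ {d} {e} {f} p q = begin
    e ⊙ f                            ≈⟨ unfold f ⟩
    f ⊕ e ⊙ 𝟘                        ≈⟨ ⊕-cong q ≈-refl ⟩
    τ d ⊕ f ⊙ 𝟘 ⊕ e ⊙ 𝟘              ≈⟨ ax ⊕-assoc ⟩
    τ d ⊕ (f ⊙ 𝟘 ⊕ e ⊙ 𝟘)            ≈⟨ ⊕-cong ≈-refl (unfold (f ⊙ 𝟘)) ⟨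
    τ d ⊕ e ⊙ (f ⊙ 𝟘)                ≈⟨ ⊕-cong ≈-refl (ax ⊙-assoc) ⟨
    τ d ⊕ e ⊙ f ⊙ 𝟘                  ∎
    where
    unfold : ∀ g → e ⊙ g ≈ g ⊕ e ⊙ 𝟘
    unfold g = begin
      e ⊙ g                  ≈⟨ ⊙-cong p ≈-refl ⟩
      (𝟙 ⊕ e ⊙ 𝟘) ⊙ g        ≈⟨ ax r-distr ⟩
      𝟙 ⊙ g ⊕ e ⊙ 𝟘 ⊙ g      ≈⟨ ⊕-cong (ax ⊙-idˡ) (⊙𝟘⊙ e g) ⟩
      g ⊕ e ⊙ 𝟘              ∎

  dead-* : ∀ {b e} → Dead b e → e * ≈ 𝟙 ⊕ e ⊙ 𝟘
  dead-* {b} {e} p = ≈-trans (*-unfold b (e ⊙ 𝟘) p) (⊕-cong ≈-refl (⊙𝟘⊙ e (e *)))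

  Dead-* : ∀ {b e} → Dead b e → Dead true (e *)
  Dead-* {b} {e} p = begin
    e *                          ≈⟨ dead-* p ⟩
    𝟙 ⊕ e ⊙ 𝟘                    ≈⟨ ⊕-cong ≈-refl (⊕-identityˡ _) ⟨
    𝟙 ⊕ (𝟘 ⊕ e ⊙ 𝟘)              ≈⟨ ⊕-cong ≈-refl (⊕-cong (ax ⊙-idˡ) (⊙𝟘⊙ e 𝟘)) ⟨
    𝟙 ⊕ (𝟙 ⊙ 𝟘 ⊕ e ⊙ 𝟘 ⊙ 𝟘)      ≈⟨ ⊕-cong ≈-refl (ax r-distr) ⟨
    𝟙 ⊕ (𝟙 ⊕ e ⊙ 𝟘) ⊙ 𝟘          ≈⟨ ⊕-cong ≈-refl (⊙-cong (dead-* p) ≈-refl) ⟨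
    𝟙 ⊕ e * ⊙ 𝟘                  ∎

-- Interpretation of star expressions

-- The factors of a product are swapped to match `d ∧ c` in `link` definitionally.
nullable : StExp A → Bool
nullable 𝟘        = false
nullable 𝟙        = true
nullable (atom _) = false
nullable (e ⊕ f)  = nullable e ∨ nullable f
nullable (e ⊙ f)  = nullable f ∧ nullable e
nullable (e *)    = true

nullable⇒↓ : (e : StExp A) → T (nullable e) → e ↓
nullable⇒↓ 𝟙       _ = 𝟙↓
nullable⇒↓ (e ⊕ f) t with nullable e in eq
... | true  = ⊕↓ˡ (nullable⇒↓ e (subst T (sym eq) _))
... | false = ⊕↓ʳ (nullable⇒↓ f t)
nullable⇒↓ (e ⊙ f) t with nullable f in eq
... | true  = ⊙↓ (nullable⇒↓ e t) (nullable⇒↓ f (subst T (sym eq) _))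
nullable⇒↓ (e *)   _ = *↓

open module Mil⁻-Provable {a} {A : Set a} = Provable {A = A} {S = Mil⁻} id

-- `exit` decides, with evidence, whether a star over `e` receives a loop: either a path that closes
-- the cycle, or deadness provable in `Mil⁻`.
record Interpretation {A : Set a} (e : StExp A) : Set (lsuc a) where
  field
    graph      : Graph A
    value      : Graph.P graph → StExp A
    value-init : SolvesInit graph (nullable e) e value
    value-step : Solves graph value
    exit       : Graph.ExitPath graph ⊎ Dead (nullable e) e

alt-exit : ∀ {M N : Graph A} {b d} {e f : StExp A} →
           Graph.ExitPath M ⊎ Dead b e → Graph.ExitPath N ⊎ Dead d f →
           Graph.ExitPath (alt M N) ⊎ Dead (b ∨ d) (e ⊕ f)
alt-exit {M = M} {N} (inj₁ (l , x , y , s , p , t)) _ =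
  inj₁ (l , inj₁ x , inj₁ y , s , Join.bodyˡ M N true true (λ _ → false) (λ _ ()) p , t)
alt-exit {M = M} {N} (inj₂ _) (inj₁ (l , x , y , s , p , t)) =
  inj₁ (l , inj₂ x , inj₂ y , (_ , s) , Join.bodyʳ M N true true (λ _ → false) (λ _ ()) p , t)
alt-exit (inj₂ p) (inj₂ q) = inj₂ (Dead-⊕ p q)

seq-exit : ∀ {M N : Graph A} {e f : StExp A} b d →
           Graph.ExitPath M ⊎ Dead b e → Graph.ExitPath N ⊎ Dead d f →
           Graph.ExitPath (seq b d M N) ⊎ Dead (d ∧ b) (e ⊙ f)
seq-exit {M = M} {N} b true (inj₁ (l , x , y , s , p , t)) _ =
  inj₁ (l , inj₁ x , inj₁ y , s , Join.bodyˡ M N b true (Graph.term M) (λ _ → id) p , t)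
seq-exit {M = M} {N} b false (inj₁ (l , x , y , s , p , t)) (inj₁ (l′ , x′ , y′ , s′ , p′ , t′)) =
  inj₁ (l , inj₁ x , inj₂ y′ , s ,
        Join.bodyˡ M N b false (Graph.term M) (λ _ → id) p ◅◅
        ((l′ , (t , s′) , refl) ◅ Join.bodyʳ M N b false (Graph.term M) (λ _ → id) p′) , t′)
seq-exit {e = e} b false _ (inj₂ q) = inj₂ (Dead-⊙ʳ e q)
-- The split on `d` only lets `d ∧ false` compute.
seq-exit {f = f} false true  (inj₂ p) _ = inj₂ (Dead-⊙ˡ f p)
seq-exit {f = f} false false (inj₂ p) _ = inj₂ (Dead-⊙ˡ f p)
seq-exit {M = M} {N} true d (inj₂ _) (inj₁ (l , x , y , s , p , t)) =
  inj₁ (l , inj₂ x , inj₂ y , (_ , s) , Join.bodyʳ M N true d (Graph.term M) (λ _ → id) p , t)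
seq-exit true true (inj₂ p) (inj₂ q) = inj₂ (Dead-⊙ p q)

interpret : (e : StExp A) → Interpretation e
interpret 𝟘 = record
  { graph      = empty
  ; value      = λ ()
  ; value-init = ≈-sym (ax ⊕-neutral)
  ; value-step = λ ()
  ; exit       = inj₂ (≈-sym (≈-trans (⊕-identityˡ _) (ax deadlock)))
  }
interpret 𝟙 = record
  { graph      = empty
  ; value      = λ ()
  ; value-init = ≈-sym (ax ⊕-neutral)
  ; value-step = λ ()
  ; exit       = inj₂ (≈-sym (≈-trans (⊕-cong ≈-refl (ax ⊙-idˡ)) (ax ⊕-neutral)))
  }
interpret (atom b) = record
  { graph      = point (b ∷ [])
  ; value      = λ _ → 𝟙
  ; value-init = ≈-sym (≈-trans (⊕-identityˡ _) (ax ⊙-idʳ))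
  ; value-step = λ _ → ≈-sym (ax ⊕-neutral)
  ; exit       = inj₁ (act b , tt , tt , here refl , ε , tt)
  }
interpret (e ⊕ f) = record
  { graph      = alt E.graph F.graph
  ; value      = [ E.value , F.value ]′
  ; value-init = alt-init {M = E.graph} {F.graph} E.value-init F.value-init
  ; value-step = alt-solves {M = E.graph} {F.graph} E.value-step F.value-step
  ; exit       = alt-exit {M = E.graph} {F.graph} E.exit F.exit
  }
  where
  module E = Interpretation (interpret e)
  module F = Interpretation (interpret f)
interpret (e ⊙ f) = record
  { graph      = seq (nullable e) (nullable f) E.graph F.graph
  ; value      = s
  ; value-init = link s (nullable e) (nullable f) (Graph.init E.graph) (Graph.init F.graph)
                   (τ-sum-⊙ (nullable e) E.value (Graph.init E.graph) f E.value-init) F.value-init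
  ; value-step = seq-solves {M = E.graph} {F.graph} {nullable e}
                   (⊙-before {M = E.graph} f E.value-step) F.value-init F.value-step
  ; exit       = seq-exit {M = E.graph} {F.graph} (nullable e) (nullable f) E.exit F.exit
  }
  where
  module E = Interpretation (interpret e)
  module F = Interpretation (interpret f)
  s : Graph.P E.graph ⊎ Graph.P F.graph → StExp _
  s = [ (λ p → E.value p ⊙ f) , F.value ]′
interpret {A = A} (e *) = by-exit E.exit
  where
  module E = Interpretation (interpret e)
  by-exit : Graph.ExitPath E.graph ⊎ Dead (nullable e) e → Interpretation (e *)
  by-exit (inj₁ path) = record
    { graph      = Iterate.graph E.graph path
    ; value      = [ (λ p → E.value p ⊙ e *) , const (e *) ]′
    ; value-init = start
    ; value-step = λ { (inj₁ p) → iterate-inner {M = E.graph} {s = E.value} path (e *) E.value-step p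
                     ; (inj₂ _) → start }
    ; exit       = inj₁ (let l , y , s , p = Iterate.return E.graph path in l , y , inj₂ tt , s , p , tt)
    }
    where
    -- The star vertex terminates and has the initial transitions, so one equation serves both for
    -- it and for `value-init`.
    start : e * ≈ 𝟙 ⊕ sum [ (λ p → E.value p ⊙ e *) , const (e *) ]′ (Iterate.init E.graph path)
    start = iterate-init {M = E.graph} {s = E.value} path
      (≈-trans (*-unfold (nullable e) (sum E.value (Graph.init E.graph)) E.value-init)
               (⊕-cong ≈-refl (sum-⊙ E.value (Graph.init E.graph) (e *))))
  by-exit (inj₂ dead) = record
    -- This is the automaton of `e ⊙ 𝟘`: composing with `empty` strips all positions of termination.
    { graph      = seq (nullable e) false E.graph empty
    ; value      = s
    ; value-init = ≈-trans (dead-* dead) (⊕-cong ≈-refl (≈-trans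
        (link s (nullable e) false (Graph.init E.graph) []
          (τ-sum-⊙ (nullable e) E.value (Graph.init E.graph) 𝟘 E.value-init) (≈-sym (ax ⊕-neutral)))
        (⊕-identityˡ _)))
    ; value-step = seq-solves {M = E.graph} {empty} {nullable e}
                     (⊙-before {M = E.graph} 𝟘 E.value-step) (≈-sym (ax ⊕-neutral)) (λ ())
    ; exit       = inj₂ (Dead-* dead)
    }
    where
    s : Graph.P E.graph ⊎ Graph.P (empty {A = A}) → StExp _
    s = [ (λ p → E.value p ⊙ 𝟘) , (λ ()) ]′

-- Elimination of RSP*

¬nullable : (f : StExp A) → ¬ (f ↓) → nullable f ≡ false
¬nullable f ¬f↓ with nullable f in eq
... | true  = contradiction (nullable⇒↓ f (subst T (sym eq) _)) ¬f↓
... | false = refl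

module _ {A : Set a} {e f g : StExp A} (¬f↓ : ¬ (f ↓)) where

  private
    module F = Interpretation (interpret f)
    module G = Interpretation (interpret g)

    premise : Eq A
    premise = e ≐ f ⊙ e ⊕ g

    S : Rules A a
    S = Mil⁻ +ᴬ ｛ premise ｝

    module S = Provable {S = S} inj₁

    in-S : ∀ {E} → Mil⁻ ⊢ E → S ⊢ E
    in-S = translate λ r → by (inj₁ r)

  module _ (path : Graph.ExitPath F.graph) where

    private
      star product chart : Graph A
      star    = Iterate.graph F.graph path
      product = seq true (nullable g) star G.graph
      -- `nullable g ∧ true` is what `nullable (f * ⊙ g)` computes to.
      chart   = seq true (nullable g ∧ true) (point []) product

      start-outside : ∀ i → Graph.loc chart i (inj₁ tt) ≡ outside
      start-outside (inj₂ _) = refl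

      open Elimination chart (inj₁ tt) start-outside
        using (weaklyGuarded; witness; guarded) renaming (chart to oneChart)

      module _ (x : StExp A) (fixed : x S.≈ f ⊙ x ⊕ g) where

        s : Graph.P star → StExp A
        s = [ (λ p → F.value p ⊙ x) , const x ]′

        at-star : x S.≈ g ⊕ sum s (Graph.init star)
        at-star = S.iterate-init {M = F.graph} {s = F.value} path
          (S.≈-trans fixed (S.≈-trans (S.ax ⊕-comm) (S.⊕-cong S.≈-refl f⊙x)))
          where
          f⊙x : f ⊙ x S.≈ sum (λ p → F.value p ⊙ x) (Graph.init F.graph)
          f⊙x = S.≈-trans
            (S.τ-sum-⊙ false F.value (Graph.init F.graph) x
              (subst (λ b → S.SolvesInit F.graph b f F.value) (¬nullable f ¬f↓) (in-S F.value-init)))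
            (S.⊕-identityˡ _)

        before : S.SolvesBefore star g s
        before (inj₁ p) = S.iterate-inner {M = F.graph} {s = F.value} path x (in-S ∘ F.value-step) p
        before (inj₂ _) = at-star

        solution : Graph.P chart → StExp A
        -- The start vertex gets `x` itself rather than `𝟙 ⊙ x`, so that `startˡ` and `startʳ` hold
        -- by `refl`.
        solution = [ const x , [ s , G.value ]′ ]′

        solves : S.Solves chart solution
        solves = S.seq-solves {M = point []} {product} {true} {y = x} {const x}
          (λ _ → S.≈-sym (S.ax ⊕-neutral))
          (S.link [ s , G.value ]′ true (nullable g) (Graph.init star) (Graph.init G.graph)
            at-star (in-S G.value-init))
          (S.seq-solves {M = star} {G.graph} {true} before (in-S G.value-init) (in-S ∘ G.value-step))

        provable : ProvableSolution S oneChart solution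
        -- `does (T? b)` computes to `b`, so the termination summand of the 1-chart is the one in
        -- `Solves`.
        provable p = Graph.steps chart p , (λ l q → Graph.steps⇔ chart p l q) , solves p

      e-fixed : e S.≈ f ⊙ e ⊕ g
      e-fixed = by (inj₂ (axiom refl)) []

      f*g-fixed : f * ⊙ g S.≈ f ⊙ (f * ⊙ g) ⊕ g
      f*g-fixed = S.*-⊙-unfold f g

    coproof : LLEEProvable S e (f * ⊙ g)
    coproof = record
      { chart         = oneChart
      ; weaklyGuarded = weaklyGuarded
      ; L             = λ p → solution e e-fixed p ≐ solution (f * ⊙ g) f*g-fixed p
      ; solutionˡ     = provable e e-fixed
      ; solutionʳ     = provable (f * ⊙ g) f*g-fixed
      ; startˡ        = refl
      ; startʳ        = refl
      } , witness , λ {v} {l} {w} → guarded {v} {l} {w}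

  -- A dead body f has f · x = f for all x, and then e = f + g = f* · g.
  cMil₁-rsp* : cMil₁ ⊢ premise → cMil₁ ⊢ (e ≐ f * ⊙ g)
  cMil₁-rsp* d with F.exit
  ... | inj₁ path = by (inj₂ (lcoproof₁ (coproof path))) (d ∷ [])
  ... | inj₂ dead = begin
    e                       ≈⟨ d ⟩
    f ⊙ e ⊕ g               ≈⟨ C.⊕-cong (C.dead-⊙ e f-dead) C.≈-refl ⟩
    f ⊕ g                   ≈⟨ C.⊕-cong (C.dead-⊙ (f * ⊙ g) f-dead) C.≈-refl ⟨
    f ⊙ (f * ⊙ g) ⊕ g       ≈⟨ C.*-⊙-unfold f g ⟨
    f * ⊙ g                 ∎
    where
    module C = Provable {S = cMil₁ {A = A}} inj₁
    open SetoidReasoning C.setoid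
    f-dead : C.Dead false f
    f-dead = subst (λ b → C.Dead b f) (¬nullable f ¬f↓) (translate (λ r → by (inj₁ r)) dead)

-- Derivations are data, so this recursion over them is itself the effective transformation.
Mil≾cMil₁ : (A : Set a) → Mil {A = A} ≾ cMil₁ {A = A}
Mil≾cMil₁ A E = translate simulate
  where
  simulate : ∀ {Ps E} → Mil {A = A} Ps E → All (cMil₁ ⊢_) Ps → cMil₁ ⊢ E
  simulate (inj₁ r)          ds       = by (inj₁ r) ds
  simulate (inj₂ (rsp* ¬f↓)) (d ∷ []) = cMil₁-rsp* ¬f↓ d

theorem7p5 : {a : Level} (A : Set a) →
    (Mil {A = A} ≾ cMil₁ {A = A}) ×
    ((e f : StExp A) → Mil ⊢ (e ≐ f) → cMil₁ ⊢ (e ≐ f))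
theorem7p5 A = Mil≾cMil₁ A , λ e f → Mil≾cMil₁ A (e ≐ f)
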